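{- Let $r\ge1$, let $m_1,\ldots,m_r$ be positive integers, $m=m_1+\cdots+m_r$, $\omega=m-m_1$, let $a$ be real, let $f_1,\ldots,f_r$ be real numbers none of which is a nonpositive integer, and let $$F_m(t)=\frac{(f_1+t)_{m_1}(f_2+t)_{m_2}\cdots(f_r+t)_{m_r}}{(f_1)_{m_1}(f_2)_{m_2}\cdots(f_r)_{m_r}} .$$ Then the expansion of $\hat{w}(a;F_m\,|\,x)$ in the Bernstein basis $x^k(1-x)^{m-k}$, $k=0,\ldots,m$, is given by $$\hat{w}(a;F_m\,|\,x)=(1-x)^m\,w\Big(a;F_m\,\Big|\,\frac{x}{x-1}\Big)=\sum_{k=0}^{m}(-1)^k\frac{(a)_k(-m)_k}{(f_1)_k\,k!}Q_\omega(k)\,x^k(1-x)^{m-k},$$ where $$Q_\omega=T_\omega(f_1+m_1;f_1)H,\qquad H(t)=\frac{(f_2+t)_{m_2}\cdots(f_r+t)_{m_r}}{(f_2)_{m_2}\cdots(f_r)_{m_r}},$$ and $T_\omega$ is the first Miller–Paris operator. In other words, up to the factors $(-1)^k$, the coefficients of $w(a;F_m\,|\,y)$ in the monomial basis $y^k$ are equal to the coefficients of $\hat{w}(a;F_m\,|\,x)$ in the Bernstein basis $x^k(1-x)^{m-k}$, and vice versa (with the roles of $w$ and $\hat{w}$ exchanged).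
   Context: $(b)_n=b(b+1)\cdots(b+n-1)$, $(b)_0=1$, is the Pochhammer symbol. The polynomial $\hat{w}(a;F_m\,|\,x)$ of degree at most $m$ is defined by $$\sum_{n=0}^{\infty}F_m(n)\frac{(a)_n}{n!}x^n=\frac{\hat{w}(a;F_m\,|\,x)}{(1-x)^{m+a}} .$$ The polynomial $w(a;F_m\,|\,y)$ of degree at most $m$ in $y$ is defined by $$(1-x)^a\sum_{n=0}^{\infty}F_m(n)\frac{(a)_n}{n!}x^n=w\Big(a;F_m\,\Big|\,\frac{x}{x-1}\Big),\qquad\text{i.e.}\qquad w(a;F_m\,|\,y)=\sum_{k=0}^{m}\frac{(a)_k}{k!}\Big(\sum_{j=0}^{k}\frac{(-k)_j}{j!}F_m(j)\Big)y^k .$$ First Miller–Paris operator: for an integer $\omega\ge0$ and parameters with $(\rho-\epsilon-\omega)_\omega\ne0$, $T_\omega(\epsilon;\rho)$ acts on polynomials $H$ of degree at most $\omega$ by $$[T_\omega(\epsilon;\rho)H](t)=\frac{1}{(\rho-\epsilon-\omega)_\omega}\sum_{k=0}^{\omega}\frac{(-1)^k(\epsilon)_k(-t)_k(\rho-\epsilon-\omega+t)_{\omega-k}}{k!}\sum_{j=0}^{k}\frac{(-k)_j}{j!}H(j).$$ -}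

module Defs where

open import Algebra.Apartness.Bundles using (HeytingField; module HeytingCommutativeRing)
open import Algebra.Bundles using (CommutativeRing; RawSemiring; Semiring)
import Algebra.Apartness.Properties.HeytingCommutativeRing as HeytingProperties
import Algebra.Definitions.RawSemiring as RawSemiringDefinitions
import Algebra.Properties.AbelianGroup as AbelianGroupProperties
import Algebra.Properties.Semiring.Mult as Mult
open import Data.Fin.Base using (Fin; zero; suc; toℕ)
open import Data.Nat.Base as ℕ using (ℕ; zero; suc; NonZero; _∸_)
import Data.Nat.Properties as ℕₚ
open import Data.Product.Base using (_,_; proj₁)
open import Data.Vec.Functional using (Vector; foldr)
open import Function.Base using (_∘_)
import Relation.Binary.Reasoning.Setoid as SetoidReasoning

total : ∀ {r} → Vector ℕ r → ℕ
total = foldr ℕ._+_ 0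

module Field {c ℓ₁ ℓ₂} (K : HeytingField c ℓ₁ ℓ₂) where

  open HeytingField K public hiding (zero)
  open HeytingCommutativeRing heytingCommutativeRing public using (commutativeRing)
  open CommutativeRing commutativeRing public
    using (semiring; +-abelianGroup)
  open RawSemiringDefinitions (Semiring.rawSemiring semiring) public using (_×_; _^_; sum; product)

  fromℕ : ℕ → Carrier
  fromℕ n = n × 1#

  CharacteristicZero : Set ℓ₂
  CharacteristicZero = ∀ n → .{{NonZero n}} → fromℕ n # 0#

open Field public using (CharacteristicZero)

module MillerParis
  {c ℓ₁ ℓ₂} (K : HeytingField c ℓ₁ ℓ₂) (char0 : CharacteristicZero K) where

  open Field K public hiding (CharacteristicZero)
  open HeytingProperties heytingCommutativeRing
  open AbelianGroupProperties +-abelianGroup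
    using (⁻¹-involutive; ⁻¹-∙-comm)
  open Mult semiring using (×-homo-+)
  open SetoidReasoning setoid

  infixl 7 _/_[_] _/_!

  -- #⇒invertible inverts y - 0#, which is equal to y.
  _/_[_] : Carrier → (y : Carrier) → y # 0# → Carrier
  x / y [ y#0 ] = x * proj₁ (#⇒invertible y#0)

  _/_! : Carrier → ℕ → Carrier
  x / n ! = x / fromℕ (n ℕ.!) [ char0 (n ℕ.!) {{n ℕₚ.!≢0}} ]

  ∑≤ : ℕ → (ℕ → Carrier) → Carrier
  ∑≤ n f = sum {suc n} (f ∘ toℕ)

  syntax ∑≤ n (λ k → e) = ∑[ k ≤ n ] e

  sgn : ℕ → Carrier
  sgn k = (- 1#) ^ k

  -- The Pochhammer symbol (b)ₙ = b (b + 1) ⋯ (b + n - 1).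
  poch : Carrier → ℕ → Carrier
  poch b zero    = 1#
  poch b (suc n) = poch b n * (b + fromℕ n)

  NotNonpositiveInteger : Carrier → Set ℓ₂
  NotNonpositiveInteger b = ∀ n → b # (- fromℕ n)

  x#y⇒x-y#0 : ∀ {x y} → x # y → (x - y) # 0#
  x#y⇒x-y#0 {x} {y} x#y with i , i[x-y]≈1 , _ ← #⇒invertible x#y =
    invertibleˡ⇒# (i , trans (*-congˡ (x-0≈x (x - y))) i[x-y]≈1)

  poch#0 : ∀ b N → (∀ n → n ℕ.< N → (b + fromℕ n) # 0#) → poch b N # 0#
  poch#0 b zero    _    = 1#0
  poch#0 b (suc N) b+n# =
    x#0y#0→xy#0 (poch#0 b N λ n n<N → b+n# n (ℕₚ.m<n⇒m<1+n n<N)) (b+n# N ℕₚ.≤-refl)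

  NotNonpositiveInteger⇒poch#0 : ∀ {b} → NotNonpositiveInteger b → ∀ N → poch b N # 0#
  NotNonpositiveInteger⇒poch#0 {b} b#-n N = poch#0 b N λ n _ →
    #-congʳ (+-congˡ (⁻¹-involutive (fromℕ n))) (x#y⇒x-y#0 (b#-n n))

  product#0 : ∀ {n} (v : Vector Carrier n) → (∀ i → v i # 0#) → product v # 0#
  product#0 {zero}  v v#0 = 1#0
  product#0 {suc n} v v#0 = x#0y#0→xy#0 (v#0 zero) (product#0 (v ∘ suc) (v#0 ∘ suc))

  -- (ρ - ε - ω)_ω ≠ 0 for ρ = f and ε = f + p: here ρ - ε - ω = -(p + ω).
  poch-shift#0 : ∀ f p ω → 0 ℕ.< p → poch (f - (f + fromℕ p) - fromℕ ω) ω # 0#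
  poch-shift#0 f p ω 0<p = poch#0 _ ω λ n n<ω →
    #-congʳ (sym (shift n (ω ∸ n) (ℕₚ.m∸n+n≡m (ℕₚ.<⇒≤ n<ω))))
      (x#y⇒x-y#0 (#-sym (char0 (p ℕ.+ (ω ∸ n)) {{ℕ.>-nonZero (ℕₚ.<-≤-trans 0<p (ℕₚ.m≤m+n p _))}})))
    where
    open import Relation.Binary.PropositionalEquality using (_≡_; refl)

    shift : ∀ n k {ω} → k ℕ.+ n ≡ ω →
            f - (f + fromℕ p) - fromℕ ω + fromℕ n ≈ 0# - fromℕ (p ℕ.+ k)
    shift n k refl = begin
      f - (f + fromℕ p) - fromℕ (k ℕ.+ n) + fromℕ n
        ≈⟨ +-congʳ (+-cong f-[f+p] -[k+n]) ⟩
      - fromℕ p + (- fromℕ k - fromℕ n) + fromℕ n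
        ≈⟨ +-assoc _ _ _ ⟩
      - fromℕ p + (- fromℕ k - fromℕ n + fromℕ n)
        ≈⟨ +-congˡ (trans (+-assoc _ _ _) (trans (+-congˡ (-‿inverseˡ _)) (+-identityʳ _))) ⟩
      - fromℕ p - fromℕ k
        ≈⟨ ⁻¹-∙-comm _ _ ⟩
      - (fromℕ p + fromℕ k)
        ≈⟨ -‿cong (×-homo-+ 1# p k) ⟨
      - fromℕ (p ℕ.+ k)
        ≈⟨ +-identityˡ _ ⟨
      0# - fromℕ (p ℕ.+ k)
        ∎
      where
      f-[f+p] : f - (f + fromℕ p) ≈ - fromℕ p
      f-[f+p] = begin
        f - (f + fromℕ p)       ≈⟨ +-congˡ (⁻¹-∙-comm _ _) ⟨
        f + (- f - fromℕ p)     ≈⟨ +-assoc _ _ _ ⟨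
        (f - f) - fromℕ p       ≈⟨ +-congʳ (-‿inverseʳ f) ⟩
        0# - fromℕ p            ≈⟨ +-identityˡ _ ⟩
        - fromℕ p               ∎

      -[k+n] : - fromℕ (k ℕ.+ n) ≈ - fromℕ k - fromℕ n
      -[k+n] = trans (-‿cong (×-homo-+ 1# k n)) (sym (⁻¹-∙-comm _ _))

  -- Formal power series, by their coefficients; equality is coefficientwise.
  Series : Set c
  Series = ℕ → Carrier

  infix  4 _≋_
  infixl 6 _⊕_
  infixl 7 _⊛_ _•_

  _≋_ : Series → Series → Set ℓ₁
  s ≋ t = ∀ n → s n ≈ t n

  _⊕_ _⊛_ : Series → Series → Series
  (s ⊕ t) n = s n + t n
  (s ⊛ t) n = ∑[ k ≤ n ] (s k * t (n ∸ k))

  _•_ : Carrier → Series → Series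
  (b • s) n = b * s n

  𝟘 𝟙 : Series
  𝟘 _       = 0#
  𝟙 zero    = 1#
  𝟙 (suc _) = 0#

  seriesRawSemiring : RawSemiring c ℓ₁
  seriesRawSemiring = record
    { Carrier = Series ; _≈_ = _≋_ ; _+_ = _⊕_ ; _*_ = _⊛_ ; 0# = 𝟘 ; 1# = 𝟙 }

  open RawSemiringDefinitions seriesRawSemiring public
    using () renaming (_^_ to _^ˢ_; sum to sumˢ)

  X 1-X : Series
  X zero          = 0#
  X (suc zero)    = 1#
  X (suc (suc _)) = 0#

  1-X zero          = 1#
  1-X (suc zero)    = - 1#
  1-X (suc (suc _)) = 0#

  -- x / (x - 1) = - (x + x² + x³ + ⋯)
  X/[X-1] : Series
  X/[X-1] zero    = 0#
  X/[X-1] (suc _) = - 1#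

  -- The binomial series (1 - x)ᵅ = ∑ₙ (-α)ₙ xⁿ / n!, for arbitrary α in K.
  [1-X]^_ : Carrier → Series
  ([1-X]^ α) n = poch (- α) n / n !

  -- Polynomials of degree at most m, by their monomial coefficients.
  Poly : ℕ → Set c
  Poly m = Vector Carrier (suc m)

  -- Substitution of a series s; in particular p ⟪ X ⟫ is p itself as a series.
  _⟪_⟫ : ∀ {m} → Poly m → Series → Series
  p ⟪ s ⟫ = sumˢ λ k → p k • s ^ˢ toℕ k

  bernstein : ∀ {m} → Vector Carrier (suc m) → Series
  bernstein {m} b = sumˢ λ k → b k • (X ^ˢ toℕ k ⊛ 1-X ^ˢ (m ∸ toℕ k))

  generatingSeries : Carrier → (Carrier → Carrier) → Series
  generatingSeries a F n = F (fromℕ n) * (poch a n / n !)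

  -- ∑ₙ F(n) (a)ₙ xⁿ / n! = ŵ(x) / (1 - x)ᵐ⁺ᵃ
  IsŵPolynomial : (m : ℕ) → Carrier → (Carrier → Carrier) → Poly m → Set ℓ₁
  IsŵPolynomial m a F ŵ =
    generatingSeries a F ≋ ŵ ⟪ X ⟫ ⊛ [1-X]^ (- (fromℕ m + a))

  alternatingSum : (Carrier → Carrier) → ℕ → Carrier
  alternatingSum H k = ∑[ j ≤ k ] (poch (- fromℕ k) j / j ! * H (fromℕ j))

  wPolynomial : (m : ℕ) → Carrier → (Carrier → Carrier) → Poly m
  wPolynomial m a F k = poch a (toℕ k) / toℕ k ! * alternatingSum F (toℕ k)

  -- (1 - x)ᵃ ∑ₙ F(n) (a)ₙ xⁿ / n! = w(x / (x - 1))
  IsWPolynomial : (m : ℕ) → Carrier → (Carrier → Carrier) → Poly m → Set ℓ₁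
  IsWPolynomial m a F w =
    [1-X]^ a ⊛ generatingSeries a F ≋ w ⟪ X/[X-1] ⟫

  -- [T_ω(ε; ρ) H](t), where H is only evaluated at 0, …, ω.
  MillerParisOperator :
    (ω : ℕ) (ε ρ : Carrier) → poch (ρ - ε - fromℕ ω) ω # 0# →
    (Carrier → Carrier) → Carrier → Carrier
  MillerParisOperator ω ε ρ nz H t =
    (∑[ k ≤ ω ]
      (sgn k * poch ε k * poch (- t) k * poch (ρ - ε - fromℕ ω + t) (ω ∸ k) / k !
        * alternatingSum H k))
    / poch (ρ - ε - fromℕ ω) ω [ nz ]

  pochQuotient : ∀ {r} (m : Vector ℕ r) (f : Vector Carrier r) →
                 (∀ i → NotNonpositiveInteger (f i)) → Carrier → Carrier
  pochQuotient m f f≠ t =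
    product (λ i → poch (f i + t) (m i))
      / product (λ i → poch (f i) (m i))
        [ product#0 _ (λ i → NotNonpositiveInteger⇒poch#0 (f≠ i) (m i)) ]

{-# OPTIONS --safe #-}
module Submission where

-- Write Y = x / (x - 1) and let m, ω, F, H, Q be as in the theorem.
--
-- The polynomial w.  The sums A(k) over j of (-k)_j F(j) / j! are the iterated
-- differences of F at 0 (with the sign convention u(i) - u(i + 1)), so they vanish
-- for k > m and Newton's formula (newton) gives F(n) as the sum over k of
-- A(k) (-n)_k / k!.  The generating series of (-n)_k against (a)_n / n! is
-- (a)_k Y^k (1 - x)^(-a) ([1-X]^⊛fallingSeries).  Summing over k yields the defining
-- property of w (isWPolynomial).
--
-- The polynomial ŵ.  As powers of 1 - x multiply by adding exponents (binom-⊛,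
-- the Chu–Vandermonde convolution), the defining property of ŵ is equivalent to
-- ŵ(x) = (1 - x)^m w(Y).  Since (1 - x) Y = - x, the right side is the Bernstein
-- combination with coefficients (-1)^k w_k (bernstein-sgn), and the Bernstein
-- polynomials are linearly independent (bernstein-injective).
--
-- Exchanging w and ŵ.  The substitution of Y for x is an involution which maps
-- 1 - x to its inverse, so it turns ŵ(x) = (1 - x)^m w(Y) into
-- w(x) = (1 - x)^m ŵ(Y) (homogeneous-involution).  On coefficients it is essentially
-- the passage from a sequence to its iterated differences at 0.
--
-- The operator T_ω.  It remains to see that A(k) = (-m)_k Q(k) / (f₁)_k, where F(j)
-- is (f₁ + j)_m₁ H(j) / (f₁)_m₁.  Expand H by Newton's formula.  The k-th difference
-- at 0 of (-j)_l (f₁ + j)_m₁ is, up to the factor (-1)^l (-k)_l, the difference of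
-- order k - l at l of (f₁ + j)_m₁ (Δ-fallingFactorial), which the Chu–Vandermonde
-- identity evaluates (Δ-poch).  The result matches Q(k) term by term because
-- (-m)_k (k - m)_(ω - l) = (-m)_(ω + k - l) = (-m)_ω (-m₁)_(k - l) (poch-exchange).

open import Defs
open import Algebra.Apartness.Bundles using (HeytingField)
import Algebra.Apartness.Properties.HeytingCommutativeRing as HeytingProperties
open import Algebra.Bundles using (AbelianGroup; CommutativeRing)
import Algebra.Properties.AbelianGroup as AbelianGroupProperties
import Algebra.Properties.Group as GroupProperties
import Algebra.Properties.Ring as RingProperties
import Algebra.Properties.Semiring.Mult as Mult
import Algebra.Properties.Semiring.Mult.TCOptimised as TCMult
import Algebra.Properties.Semiring.Sum as Sum
import Algebra.Solver.Ring as RingSolver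
open import Algebra.Solver.Ring.AlmostCommutativeRing
  using (fromCommutativeRing; _-Raw-AlmostCommutative⟶_)
open import Data.Fin.Base using (zero; suc; toℕ)
import Data.Fin.Properties as Finₚ
import Data.Integer.Base as ℤ
import Data.Integer.Properties as ℤₚ
import Data.Maybe.Base as Maybe
open import Data.Nat.Base as ℕ using (ℕ; zero; suc; _∸_)
import Data.Nat.Properties as ℕₚ
open import Data.Product.Base using (∃; _×_; _,_; proj₁; proj₂)
open import Data.Vec.Functional using (Vector; head; tail)
open import Function.Base using (_∘_)
open import Function.Bundles using (_⇔_; mk⇔; module Equivalence)
import Relation.Binary.PropositionalEquality as ≡
open ≡ using (_≡_)
import Relation.Binary.Reasoning.Setoid as SetoidReasoning
open import Relation.Nullary.Decidable using (yes; no; dec⇒maybe)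

-- Ring normalisation

-- The ring solver for a commutative ring, with integer coefficients, so that
-- it recognises cancellations such as x - x ≈ 0#.
module IntegerCoefficientSolver {c ℓ} (R : CommutativeRing c ℓ) where

  open CommutativeRing R
  open ℤ using (ℤ; +_; -[1+_]; _⊖_)
  open RingProperties ring using (-‿distribˡ-*; -‿distribʳ-*; -0#≈0#; -‿involutive)
  open AbelianGroupProperties +-abelianGroup using (⁻¹-∙-comm)
  open TCMult semiring using () renaming (_×_ to _×′_)
  open TCMult semiring using (1+×; ×-homo-+; ×1-homo-*)
  open SetoidReasoning setoid

  ⟦_⟧ℤ : ℤ → Carrier
  ⟦ + n ⟧ℤ      = n ×′ 1#
  ⟦ -[1+ n ] ⟧ℤ = - (suc n ×′ 1#)

  ⟦-⟧ : ∀ i → ⟦ ℤ.- i ⟧ℤ ≈ - ⟦ i ⟧ℤ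
  ⟦-⟧ (+ zero)   = sym -0#≈0#
  ⟦-⟧ (+ suc n)  = refl
  ⟦-⟧ -[1+ n ]   = sym (-‿involutive _)

  ⟦⊖⟧ : ∀ m n → ⟦ m ⊖ n ⟧ℤ ≈ m ×′ 1# - n ×′ 1#
  ⟦⊖⟧ m       zero    = sym (trans (+-congˡ -0#≈0#) (+-identityʳ _))
  ⟦⊖⟧ zero    (suc n) = sym (+-identityˡ _)
  ⟦⊖⟧ (suc m) (suc n) = begin
    ⟦ suc m ⊖ suc n ⟧ℤ                       ≡⟨ ≡.cong ⟦_⟧ℤ (ℤₚ.[1+m]⊖[1+n]≡m⊖n m n) ⟩
    ⟦ m ⊖ n ⟧ℤ                               ≈⟨ ⟦⊖⟧ m n ⟩
    m ×′ 1# - n ×′ 1#                        ≈⟨ +-congˡ (+-identityˡ _) ⟨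
    m ×′ 1# + (0# - n ×′ 1#)                 ≈⟨ +-congˡ (+-congʳ (-‿inverseʳ 1#)) ⟨
    m ×′ 1# + (1# - 1# - n ×′ 1#)            ≈⟨ +-congˡ (+-assoc _ _ _) ⟩
    m ×′ 1# + (1# + (- 1# - n ×′ 1#))        ≈⟨ +-assoc _ _ _ ⟨
    m ×′ 1# + 1# + (- 1# - n ×′ 1#)          ≈⟨ +-cong (+-comm _ _) (⁻¹-∙-comm _ _) ⟩
    1# + m ×′ 1# - (1# + n ×′ 1#)            ≈⟨ +-cong (1+× m 1#) (-‿cong (1+× n 1#)) ⟨
    suc m ×′ 1# - suc n ×′ 1#                ∎

  ⟦+⟧ : ∀ i j → ⟦ i ℤ.+ j ⟧ℤ ≈ ⟦ i ⟧ℤ + ⟦ j ⟧ℤ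
  ⟦+⟧ (+ m)    (+ n)    = ×-homo-+ 1# m n
  ⟦+⟧ (+ m)    -[1+ n ] = ⟦⊖⟧ m (suc n)
  ⟦+⟧ -[1+ m ] (+ n)    = trans (⟦⊖⟧ n (suc m)) (+-comm _ _)
  ⟦+⟧ -[1+ m ] -[1+ n ] = begin
    - (suc (suc (m ℕ.+ n)) ×′ 1#)    ≡⟨ ≡.cong (λ k → - (k ×′ 1#)) (≡.sym (≡.cong suc (ℕₚ.+-suc m n))) ⟩
    - ((suc m ℕ.+ suc n) ×′ 1#)      ≈⟨ -‿cong (×-homo-+ 1# (suc m) (suc n)) ⟩
    - (suc m ×′ 1# + suc n ×′ 1#)    ≈⟨ ⁻¹-∙-comm _ _ ⟨
    - (suc m ×′ 1#) - suc n ×′ 1#    ∎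

  ⟦+m*⟧ : ∀ m j → ⟦ + m ℤ.* j ⟧ℤ ≈ m ×′ 1# * ⟦ j ⟧ℤ
  ⟦+m*⟧ m (+ n) = begin
    ⟦ + m ℤ.* + n ⟧ℤ     ≡⟨ ≡.cong ⟦_⟧ℤ (ℤₚ.pos-* m n) ⟨
    (m ℕ.* n) ×′ 1#      ≈⟨ ×1-homo-* m n ⟩
    m ×′ 1# * n ×′ 1#    ∎
  ⟦+m*⟧ m -[1+ n ] = begin
    ⟦ + m ℤ.* -[1+ n ] ⟧ℤ             ≡⟨ ≡.cong ⟦_⟧ℤ (ℤₚ.neg-distribʳ-* (+ m) (+ suc n)) ⟨
    ⟦ ℤ.- (+ m ℤ.* + suc n) ⟧ℤ        ≈⟨ ⟦-⟧ (+ m ℤ.* + suc n) ⟩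
    - ⟦ + m ℤ.* + suc n ⟧ℤ            ≈⟨ -‿cong (⟦+m*⟧ m (+ suc n)) ⟩
    - (m ×′ 1# * suc n ×′ 1#)         ≈⟨ -‿distribʳ-* _ _ ⟩
    m ×′ 1# * - (suc n ×′ 1#)         ∎

  ⟦*⟧ : ∀ i j → ⟦ i ℤ.* j ⟧ℤ ≈ ⟦ i ⟧ℤ * ⟦ j ⟧ℤ
  ⟦*⟧ (+ m)    j = ⟦+m*⟧ m j
  ⟦*⟧ -[1+ m ] j = begin
    ⟦ -[1+ m ] ℤ.* j ⟧ℤ          ≡⟨ ≡.cong ⟦_⟧ℤ (ℤₚ.neg-distribˡ-* (+ suc m) j) ⟨
    ⟦ ℤ.- (+ suc m ℤ.* j) ⟧ℤ     ≈⟨ ⟦-⟧ (+ suc m ℤ.* j) ⟩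
    - ⟦ + suc m ℤ.* j ⟧ℤ         ≈⟨ -‿cong (⟦+m*⟧ (suc m) j) ⟩
    - (suc m ×′ 1# * ⟦ j ⟧ℤ)     ≈⟨ -‿distribˡ-* _ _ ⟩
    - (suc m ×′ 1#) * ⟦ j ⟧ℤ     ∎

  ℤ⟶R : ℤ.+-*-rawRing -Raw-AlmostCommutative⟶ fromCommutativeRing R
  ℤ⟶R = record
    { ⟦_⟧ = ⟦_⟧ℤ ; +-homo = ⟦+⟧ ; *-homo = ⟦*⟧ ; -‿homo = ⟦-⟧ ; 0-homo = refl ; 1-homo = refl }

  open RingSolver ℤ.+-*-rawRing (fromCommutativeRing R) ℤ⟶R
    (λ i j → Maybe.map (λ i≡j → reflexive (≡.cong ⟦_⟧ℤ i≡j)) (dec⇒maybe (i ℤₚ.≟ j))) public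
    using (solve; _:=_; _:+_; _:*_; _:-_; :-_; con; Polynomial)

  :0 :1 : ∀ {n} → Polynomial n
  :0 = con (+ 0)
  :1 = con (+ 1)

-- Inverses, factorials, Pochhammer symbols and finite sums

module Arithmetic {c ℓ₁ ℓ₂} (K : HeytingField c ℓ₁ ℓ₂) (char0 : CharacteristicZero K) where

  open MillerParis K char0
  open IntegerCoefficientSolver commutativeRing public
  open HeytingProperties heytingCommutativeRing using (x-0≈x)
  open Mult semiring using (×1-homo-*) renaming (×-homo-+ to ×-homo-+ᴷ)
  open Sum semiring using (*-distribˡ-sum)
  open SetoidReasoning setoid

  fromℕ-+ : ∀ m n → fromℕ (m ℕ.+ n) ≈ fromℕ m + fromℕ n
  fromℕ-+ = ×-homo-+ᴷ 1#

  -- The inverse by which _/_[_] multiplies: x / y [ y#0 ] is x * recip y#0 by definition.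
  recip : ∀ {y} → y # 0# → Carrier
  recip y#0 = proj₁ (#⇒invertible y#0)

  recip-inverseˡ : ∀ {y} (y#0 : y # 0#) → recip y#0 * y ≈ 1#
  recip-inverseˡ {y} y#0 =
    trans (*-congˡ (sym (x-0≈x y))) (proj₁ (proj₂ (#⇒invertible y#0)))

  *-cancelʳ-# : ∀ {x z y} → y # 0# → x * y ≈ z * y → x ≈ z
  *-cancelʳ-# {x} {z} {y} y#0 xy≈zy = begin
    x                      ≈⟨ expand x ⟩
    x * y * recip y#0      ≈⟨ *-congʳ xy≈zy ⟩
    z * y * recip y#0      ≈⟨ expand z ⟨
    z                      ∎
    where
    expand : ∀ u → u ≈ u * y * recip y#0
    expand u = begin
      u                      ≈⟨ *-identityʳ u ⟨
      u * 1#                 ≈⟨ *-congˡ (recip-inverseˡ y#0) ⟨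
      u * (recip y#0 * y)    ≈⟨ solve 3 (λ u r y → u :* (r :* y) := u :* y :* r) refl u (recip y#0) y ⟩
      u * y * recip y#0      ∎

  !#0 : ∀ n → fromℕ (n ℕ.!) # 0#
  !#0 n = char0 (n ℕ.!) {{n ℕₚ.!≢0}}

  -- x / n ! is x * 1/ n ! by definition.
  1/_! : ℕ → Carrier
  1/ n ! = recip (!#0 n)

  1/0! : 1/ 0 ! ≈ 1#
  1/0! = begin
    1/ 0 !                ≈⟨ solve 1 (λ r → r := r :* (:1 :+ :0)) refl (1/ 0 !) ⟩
    1/ 0 ! * fromℕ 1      ≈⟨ recip-inverseˡ (!#0 0) ⟩
    1#                    ∎

  1/suc! : ∀ n → 1/ n ! ≈ fromℕ (suc n) * 1/ suc n !
  1/suc! n = *-cancelʳ-# (!#0 n) (begin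
    1/ n ! * fromℕ (n ℕ.!)                        ≈⟨ recip-inverseˡ (!#0 n) ⟩
    1#                                            ≈⟨ recip-inverseˡ (!#0 (suc n)) ⟨
    1/ suc n ! * fromℕ (suc n ℕ.* n ℕ.!)          ≈⟨ *-congˡ (×1-homo-* (suc n) (n ℕ.!)) ⟩
    1/ suc n ! * (fromℕ (suc n) * fromℕ (n ℕ.!))  ≈⟨ solve 3 (λ r s t → r :* (s :* t) := s :* r :* t)
         refl (1/ suc n !) (fromℕ (suc n)) (fromℕ (n ℕ.!)) ⟩
    fromℕ (suc n) * 1/ suc n ! * fromℕ (n ℕ.!)    ∎)

  poch-cong : ∀ {b b′} n → b ≈ b′ → poch b n ≈ poch b′ n
  poch-cong zero    b≈b′ = refl
  poch-cong (suc n) b≈b′ = *-cong (poch-cong n b≈b′) (+-congʳ b≈b′)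

  poch-suc : ∀ b n → poch b (suc n) ≈ b * poch (b + 1#) n
  poch-suc b zero    = solve 1 (λ b → :1 :* (b :+ :0) := b :* :1) refl b
  poch-suc b (suc n) = begin
    poch b (suc n) * (b + fromℕ (suc n))             ≈⟨ *-congʳ (poch-suc b n) ⟩
    b * poch (b + 1#) n * (b + fromℕ (suc n))        ≈⟨ solve 3 (λ b p n → b :* p :* (b :+ (:1 :+ n)) := b :* (p :* (b :+ :1 :+ n)))
         refl b (poch (b + 1#) n) (fromℕ n) ⟩
    b * (poch (b + 1#) n * (b + 1# + fromℕ n))       ∎

  poch-+ : ∀ b m n → poch b (m ℕ.+ n) ≈ poch b m * poch (b + fromℕ m) n
  poch-+ b zero    n = begin
    poch b n                    ≈⟨ poch-cong n (+-identityʳ b) ⟨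
    poch (b + 0#) n             ≈⟨ *-identityˡ _ ⟨
    1# * poch (b + 0#) n        ∎
  poch-+ b (suc m) n = begin
    poch b (suc (m ℕ.+ n))                               ≈⟨ poch-suc b (m ℕ.+ n) ⟩
    b * poch (b + 1#) (m ℕ.+ n)                          ≈⟨ *-congˡ (poch-+ (b + 1#) m n) ⟩
    b * (poch (b + 1#) m * poch (b + 1# + fromℕ m) n)    ≈⟨ *-assoc _ _ _ ⟨
    b * poch (b + 1#) m * poch (b + 1# + fromℕ m) n      ≈⟨ *-cong (sym (poch-suc b m)) (poch-cong n (+-assoc _ _ _)) ⟩
    poch b (suc m) * poch (b + fromℕ (suc m)) n          ∎

  poch-neg-suc : ∀ n j → poch (- fromℕ (suc n)) (suc j) ≈ - fromℕ (suc n) * poch (- fromℕ n) j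
  poch-neg-suc n j = trans (poch-suc _ j) (*-congˡ (poch-cong j
    (solve 1 (λ n → :- (:1 :+ n) :+ :1 := :- n) refl (fromℕ n))))

  -- The product (-n)_j contains the factor -n + n as soon as j > n.
  poch-neg-vanish : ∀ {n j} → n ℕ.< j → poch (- fromℕ n) j ≈ 0#
  poch-neg-vanish {zero}  {suc j} _           = begin
    poch (- 0#) (suc j)               ≈⟨ poch-suc _ j ⟩
    - 0# * poch (- 0# + 1#) j         ≈⟨ solve 1 (λ p → :- :0 :* p := :0) refl _ ⟩
    0#                                ∎
  poch-neg-vanish {suc n} {suc j} (ℕ.s≤s n<j) = begin
    poch (- fromℕ (suc n)) (suc j)         ≈⟨ poch-neg-suc n j ⟩
    - fromℕ (suc n) * poch (- fromℕ n) j   ≈⟨ *-congˡ (poch-neg-vanish n<j) ⟩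
    - fromℕ (suc n) * 0#                   ≈⟨ zeroʳ _ ⟩
    0#                                     ∎

  ∑≤-cong-bounded : ∀ n {f g} → (∀ k → k ℕ.≤ n → f k ≈ g k) → ∑≤ n f ≈ ∑≤ n g
  ∑≤-cong-bounded zero    f≈g = +-congʳ (f≈g 0 ℕ.z≤n)
  ∑≤-cong-bounded (suc n) f≈g =
    +-cong (f≈g 0 ℕ.z≤n) (∑≤-cong-bounded n (λ k k≤n → f≈g (suc k) (ℕ.s≤s k≤n)))

  ∑≤-cong : ∀ n {f g} → (∀ k → f k ≈ g k) → ∑≤ n f ≈ ∑≤ n g
  ∑≤-cong n f≈g = ∑≤-cong-bounded n (λ k _ → f≈g k)

  ∑≤-last : ∀ n f → ∑≤ (suc n) f ≈ ∑≤ n f + f (suc n)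
  ∑≤-last zero    f = solve 2 (λ x y → x :+ (y :+ :0) := x :+ :0 :+ y) refl (f 0) (f 1)
  ∑≤-last (suc n) f = trans (+-congˡ (∑≤-last n (f ∘ suc))) (sym (+-assoc _ _ _))

  ∑≤-extend : ∀ d n f → (∀ k → n ℕ.< k → f k ≈ 0#) → ∑≤ (d ℕ.+ n) f ≈ ∑≤ n f
  ∑≤-extend zero    n f f≈0 = refl
  ∑≤-extend (suc d) n f f≈0 = begin
    ∑≤ (suc (d ℕ.+ n)) f                  ≈⟨ ∑≤-last (d ℕ.+ n) f ⟩
    ∑≤ (d ℕ.+ n) f + f (suc (d ℕ.+ n))    ≈⟨ +-cong (∑≤-extend d n f f≈0) (f≈0 _ (ℕ.s≤s (ℕₚ.m≤n+m n d))) ⟩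
    ∑≤ n f + 0#                           ≈⟨ +-identityʳ _ ⟩
    ∑≤ n f                                ∎

  ∑≤-minus : ∀ N f g → (∑[ l ≤ N ] (f l - g l)) ≈ ∑≤ N f - ∑≤ N g
  ∑≤-minus zero    f g = solve 2 (λ x y → x :- y :+ :0 := x :+ :0 :- (y :+ :0)) refl (f 0) (g 0)
  ∑≤-minus (suc N) f g = trans (+-congˡ (∑≤-minus N (f ∘ suc) (g ∘ suc)))
    (solve 4 (λ x y z w → (x :- y) :+ (z :- w) := (x :+ z) :- (y :+ w))
      refl (f 0) (g 0) (∑≤ N (f ∘ suc)) (∑≤ N (g ∘ suc)))

  ∑≤-*ˡ : ∀ N b f → b * ∑≤ N f ≈ ∑[ l ≤ N ] (b * f l)
  ∑≤-*ˡ N b f = *-distribˡ-sum b (f ∘ toℕ {suc N})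

-- Iterated differences

module FiniteDifferences {c ℓ₁ ℓ₂} (K : HeytingField c ℓ₁ ℓ₂) (char0 : CharacteristicZero K) where

  open MillerParis K char0
  open Arithmetic K char0
  open SetoidReasoning setoid

  -- The n-th difference of a sequence, with the sign convention Δ 1 u i = u i - u (1 + i).
  -- Sequences share the type Series with power series.
  Δ : ℕ → Series → Series
  Δ zero    u i = u i
  Δ (suc n) u i = Δ n u i - Δ n u (suc i)

  Δ-cong : ∀ n {u v} → u ≋ v → Δ n u ≋ Δ n v
  Δ-cong zero    u≋v i = u≋v i
  Δ-cong (suc n) u≋v i = +-cong (Δ-cong n u≋v i) (-‿cong (Δ-cong n u≋v (suc i)))

  Δ-⊕ : ∀ n u v → Δ n (u ⊕ v) ≋ Δ n u ⊕ Δ n v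
  Δ-⊕ zero    u v i = refl
  Δ-⊕ (suc n) u v i = begin
    Δ n (u ⊕ v) i - Δ n (u ⊕ v) (suc i)
      ≈⟨ +-cong (Δ-⊕ n u v i) (-‿cong (Δ-⊕ n u v (suc i))) ⟩
    (Δ n u i + Δ n v i) - (Δ n u (suc i) + Δ n v (suc i))
      ≈⟨ solve 4 (λ p q r s → (p :+ q) :- (r :+ s) := (p :- r) :+ (q :- s))
           refl (Δ n u i) (Δ n v i) (Δ n u (suc i)) (Δ n v (suc i)) ⟩
    Δ (suc n) u i + Δ (suc n) v i ∎

  Δ-• : ∀ n b u → Δ n (b • u) ≋ b • Δ n u
  Δ-• zero    b u i = refl
  Δ-• (suc n) b u i = begin
    Δ n (b • u) i - Δ n (b • u) (suc i)    ≈⟨ +-cong (Δ-• n b u i) (-‿cong (Δ-• n b u (suc i))) ⟩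
    b * Δ n u i - b * Δ n u (suc i)        ≈⟨ solve 3 (λ b p q → b :* p :- b :* q := b :* (p :- q))
         refl b (Δ n u i) (Δ n u (suc i)) ⟩
    b * Δ (suc n) u i                      ∎

  Δ-𝟘 : ∀ n → Δ n 𝟘 ≋ 𝟘
  Δ-𝟘 zero    i = refl
  Δ-𝟘 (suc n) i = trans (+-cong (Δ-𝟘 n i) (-‿cong (Δ-𝟘 n (suc i)))) (-‿inverseʳ 0#)

  Δ-∑≤ : ∀ n N (v : ℕ → Series) → Δ n (λ j → ∑[ l ≤ N ] v l j) ≋ λ i → ∑[ l ≤ N ] Δ n (v l) i
  Δ-∑≤ zero    N v i = refl
  Δ-∑≤ (suc n) N v i = begin
    Δ n (λ j → ∑[ l ≤ N ] v l j) i - Δ n (λ j → ∑[ l ≤ N ] v l j) (suc i)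
      ≈⟨ +-cong (Δ-∑≤ n N v i) (-‿cong (Δ-∑≤ n N v (suc i))) ⟩
    (∑[ l ≤ N ] Δ n (v l) i) - (∑[ l ≤ N ] Δ n (v l) (suc i))
      ≈⟨ ∑≤-minus N (λ l → Δ n (v l) i) (λ l → Δ n (v l) (suc i)) ⟨
    ∑[ l ≤ N ] Δ (suc n) (v l) i ∎

  Δ-tail : ∀ n u i → Δ n (u ∘ suc) i ≈ Δ n u (suc i)
  Δ-tail zero    u i = refl
  Δ-tail (suc n) u i = +-cong (Δ-tail n u i) (-‿cong (Δ-tail n u (suc i)))

  -- Since u - (u - shift u) = shift u, differencing the sequence l ↦ Δ l u i in l
  -- raises i.
  Δ-Δ : ∀ n u i j → Δ n (λ l → Δ l u i) j ≈ Δ j u (n ℕ.+ i)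
  Δ-Δ zero    u i j = refl
  Δ-Δ (suc n) u i j = begin
    Δ n (λ l → Δ l u i) j - Δ n (λ l → Δ l u i) (suc j)
      ≈⟨ +-cong (Δ-Δ n u i j) (-‿cong (Δ-Δ n u i (suc j))) ⟩
    Δ j u (n ℕ.+ i) - (Δ j u (n ℕ.+ i) - Δ j u (suc (n ℕ.+ i)))
      ≈⟨ solve 2 (λ p q → p :- (p :- q) := q) refl (Δ j u (n ℕ.+ i)) (Δ j u (suc (n ℕ.+ i))) ⟩
    Δ j u (suc n ℕ.+ i) ∎

  -- Binomial inversion.
  Δ-involutive : ∀ n u → Δ n (λ l → Δ l u 0) 0 ≈ u n
  Δ-involutive n u = trans (Δ-Δ n u 0 0) (reflexive (≡.cong u (ℕₚ.+-identityʳ n)))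

  -- The Leibniz rule for the product with b + j; the factor suc n comes from
  -- b + j having the constant difference -1.
  Δ-linear-factor : ∀ n b u i →
    Δ (suc n) (λ j → (b + fromℕ j) * u j) i
      ≈ (b + fromℕ i) * Δ (suc n) u i - fromℕ (suc n) * Δ n u (suc i)
  Δ-linear-factor zero b u i =
    solve 4 (λ b i p q →
      (b :+ i) :* p :- (b :+ (:1 :+ i)) :* q
        := (b :+ i) :* (p :- q) :- (:1 :+ :0) :* q)
      refl b (fromℕ i) (u i) (u (suc i))
  Δ-linear-factor (suc n) b u i = begin
    Δ (suc n) bu i - Δ (suc n) bu (suc i)
      ≈⟨ +-cong (Δ-linear-factor n b u i) (-‿cong (Δ-linear-factor n b u (suc i))) ⟩
    ((b + fromℕ i) * Δ (suc n) u i - fromℕ (suc n) * q)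
      - ((b + fromℕ (suc i)) * (q - r) - fromℕ (suc n) * r)
      ≈⟨ solve 6 (λ b i n p q r →
           ((b :+ i) :* p :- (:1 :+ n) :* q) :- ((b :+ (:1 :+ i)) :* (q :- r) :- (:1 :+ n) :* r)
             := (b :+ i) :* (p :- (q :- r)) :- (:1 :+ (:1 :+ n)) :* (q :- r))
           refl b (fromℕ i) (fromℕ n) (Δ (suc n) u i) q r ⟩
    (b + fromℕ i) * Δ (suc (suc n)) u i - fromℕ (suc (suc n)) * Δ (suc n) u (suc i) ∎
    where
    bu = λ j → (b + fromℕ j) * u j
    q = Δ n u (suc i)
    r = Δ n u (suc (suc i))

  -- (-n)_j / j!, which is (-1)^j times the binomial coefficient of n and j.
  signedBinomial : ℕ → ℕ → Carrier
  signedBinomial n j = poch (- fromℕ n) j / j !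

  signedBinomial-0 : ∀ n → signedBinomial n 0 ≈ 1#
  signedBinomial-0 n = trans (*-identityˡ _) 1/0!

  signedBinomial-vanish : ∀ {n j} → n ℕ.< j → signedBinomial n j ≈ 0#
  signedBinomial-vanish n<j = trans (*-congʳ (poch-neg-vanish n<j)) (zeroˡ _)

  -- Pascal's rule.
  signedBinomial-suc : ∀ n j →
    signedBinomial (suc n) (suc j) ≈ signedBinomial n (suc j) - signedBinomial n j
  signedBinomial-suc n j = begin
    poch (- fromℕ (suc n)) (suc j) * 1/ suc j !
      ≈⟨ *-congʳ (poch-neg-suc n j) ⟩
    - fromℕ (suc n) * p * 1/ suc j !
      ≈⟨ solve 4 (λ n j p r → :- (:1 :+ n) :* p :* r := p :* (:- n :+ j) :* r :- p :* ((:1 :+ j) :* r))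
           refl (fromℕ n) (fromℕ j) p (1/ suc j !) ⟩
    p * (- fromℕ n + fromℕ j) * 1/ suc j ! - p * (fromℕ (suc j) * 1/ suc j !)
      ≈⟨ +-congˡ (-‿cong (*-congˡ (1/suc! j))) ⟨
    p * (- fromℕ n + fromℕ j) * 1/ suc j ! - p * 1/ j ! ∎
    where p = poch (- fromℕ n) j

  -- The explicit form of the n-th difference, by Pascal's rule.
  Δ≈∑ : ∀ n u → (∑[ j ≤ n ] (signedBinomial n j * u j)) ≈ Δ n u 0
  Δ≈∑ zero u = begin
    signedBinomial 0 0 * u 0 + 0#   ≈⟨ +-identityʳ _ ⟩
    signedBinomial 0 0 * u 0        ≈⟨ *-congʳ (signedBinomial-0 0) ⟩
    1# * u 0                        ≈⟨ *-identityˡ _ ⟩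
    u 0                             ∎
  Δ≈∑ (suc n) u = begin
    β (suc n) 0 * u 0 + (∑[ j ≤ n ] (β (suc n) (suc j) * u (suc j)))
      ≈⟨ +-cong (*-congʳ (trans (signedBinomial-0 (suc n)) (sym (signedBinomial-0 n)))) (∑≤-cong n pascal) ⟩
    β n 0 * u 0 + (∑[ j ≤ n ] (β n (suc j) * u (suc j) - β n j * u (suc j)))
      ≈⟨ +-congˡ (∑≤-minus n (λ j → β n (suc j) * u (suc j)) (λ j → β n j * u (suc j))) ⟩
    β n 0 * u 0 + ((∑[ j ≤ n ] (β n (suc j) * u (suc j))) - (∑[ j ≤ n ] (β n j * u (suc j))))
      ≈⟨ +-assoc _ _ _ ⟨
    (∑[ j ≤ suc n ] (β n j * u j)) - (∑[ j ≤ n ] (β n j * u (suc j)))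
      ≈⟨ +-cong (trans (∑≤-last n (λ j → β n j * u j)) last≈0) (-‿cong (Δ≈∑ n (u ∘ suc))) ⟩
    (∑[ j ≤ n ] (β n j * u j)) - Δ n (u ∘ suc) 0
      ≈⟨ +-cong (Δ≈∑ n u) (-‿cong (Δ-tail n u 0)) ⟩
    Δ (suc n) u 0 ∎
    where
    β = signedBinomial
    pascal : ∀ j → β (suc n) (suc j) * u (suc j) ≈ β n (suc j) * u (suc j) - β n j * u (suc j)
    pascal j = trans (*-congʳ (signedBinomial-suc n j))
      (solve 3 (λ x y z → (x :- y) :* z := x :* z :- y :* z) refl (β n (suc j)) (β n j) (u (suc j)))
    last≈0 : (∑[ j ≤ n ] (β n j * u j)) + β n (suc n) * u (suc n) ≈ ∑[ j ≤ n ] (β n j * u j)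
    last≈0 = trans (+-congˡ (trans (*-congʳ (signedBinomial-vanish (ℕₚ.n<1+n n))) (zeroˡ _))) (+-identityʳ _)

  alternatingSum≈Δ : ∀ H k → alternatingSum H k ≈ Δ k (H ∘ fromℕ) 0
  alternatingSum≈Δ H k = Δ≈∑ k (H ∘ fromℕ)

  -- The values of a polynomial of degree at most m, expressed by the vanishing of
  -- all differences of order above m.
  Degree≤ : ℕ → Series → Set ℓ₁
  Degree≤ m u = ∀ n i → m ℕ.< n → Δ n u i ≈ 0#

  -- Newton's expansion.  Binomial inversion gives the sum over l ≤ n; its terms with
  -- l > m and those of the sum over l ≤ m with l > n are zero.
  newton : ∀ {m u} → Degree≤ m u → ∀ n → u n ≈ ∑[ l ≤ m ] (signedBinomial n l * Δ l u 0)
  newton {m} {u} deg n = begin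
    u n                 ≈⟨ Δ-involutive n u ⟨
    Δ n (λ l → Δ l u 0) 0 ≈⟨ Δ≈∑ n _ ⟨
    ∑≤ n t              ≈⟨ ∑≤-extend m n t (λ k n<k → trans (*-congʳ (signedBinomial-vanish n<k)) (zeroˡ _)) ⟨
    ∑≤ (m ℕ.+ n) t      ≡⟨ ≡.cong (λ N → ∑≤ N t) (ℕₚ.+-comm m n) ⟩
    ∑≤ (n ℕ.+ m) t      ≈⟨ ∑≤-extend n m t (λ k m<k → trans (*-congˡ (deg k 0 m<k)) (zeroʳ _)) ⟩
    ∑≤ m t              ∎
    where t = λ l → signedBinomial n l * Δ l u 0

  Degree≤-cong : ∀ {m u v} → u ≋ v → Degree≤ m u → Degree≤ m v
  Degree≤-cong u≋v deg n i m<n = trans (sym (Δ-cong n u≋v i)) (deg n i m<n)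

  Degree≤-• : ∀ {m u} b → Degree≤ m u → Degree≤ m (b • u)
  Degree≤-• b deg n i m<n = trans (Δ-• n b _ i) (trans (*-congˡ (deg n i m<n)) (zeroʳ b))

  Degree≤-1 : Degree≤ 0 (λ _ → 1#)
  Degree≤-1 (suc zero)    i _ = -‿inverseʳ 1#
  Degree≤-1 (suc (suc n)) i _ = trans
    (+-cong (Degree≤-1 (suc n) i (ℕ.s≤s ℕ.z≤n)) (-‿cong (Degree≤-1 (suc n) (suc i) (ℕ.s≤s ℕ.z≤n))))
    (-‿inverseʳ 0#)

  Degree≤-linear-factor : ∀ {m u} b → Degree≤ m u → Degree≤ (suc m) (λ j → (b + fromℕ j) * u j)
  Degree≤-linear-factor {m} {u} b deg (suc n) i (ℕ.s≤s m<n) = begin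
    Δ (suc n) (λ j → (b + fromℕ j) * u j) i                            ≈⟨ Δ-linear-factor n b u i ⟩
    (b + fromℕ i) * Δ (suc n) u i - fromℕ (suc n) * Δ n u (suc i)
      ≈⟨ +-cong (*-congˡ (deg (suc n) i (ℕₚ.m<n⇒m<1+n m<n))) (-‿cong (*-congˡ (deg n (suc i) m<n))) ⟩
    (b + fromℕ i) * 0# - fromℕ (suc n) * 0#
      ≈⟨ solve 2 (λ x y → x :* :0 :- y :* :0 := :0) refl (b + fromℕ i) (fromℕ (suc n)) ⟩
    0# ∎

  Degree≤-poch : ∀ {m u} b p → Degree≤ m u → Degree≤ (p ℕ.+ m) (λ j → poch (b + fromℕ j) p * u j)
  Degree≤-poch b zero    deg = Degree≤-cong (λ j → sym (*-identityˡ _)) deg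
  Degree≤-poch {m} {u} b (suc p) deg = Degree≤-cong
    (λ j → solve 5 (λ b p j x y → (b :+ p :+ j) :* (x :* y) := x :* (b :+ j :+ p) :* y)
      refl b (fromℕ p) (fromℕ j) (poch (b + fromℕ j) p) (u j))
    (Degree≤-linear-factor (b + fromℕ p) (Degree≤-poch b p deg))

  Degree≤-product : ∀ {r} (ms : Vector ℕ r) (f : Vector Carrier r) →
    Degree≤ (total ms) (λ j → product (λ i → poch (f i + fromℕ j) (ms i)))
  Degree≤-product {zero}  ms f = Degree≤-1
  Degree≤-product {suc r} ms f = Degree≤-poch (head f) (head ms) (Degree≤-product (tail ms) (tail f))

  Degree≤-pochQuotient : ∀ {r} (ms : Vector ℕ r) (f : Vector Carrier r) f≠ →
    Degree≤ (total ms) (pochQuotient ms f f≠ ∘ fromℕ)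
  Degree≤-pochQuotient ms f f≠ =
    Degree≤-cong (λ j → *-comm _ _) (Degree≤-• _ (Degree≤-product ms f))

  -- The Chu–Vandermonde identity: the n-th difference of (b + j)_p at j = i is
  -- (-p)_n (b + i)_p / (b + i)_n, here without the division.
  Δ-poch : ∀ n b p i →
    Δ n (λ j → poch (b + fromℕ j) p) i * poch (b + fromℕ i) n ≈ poch (- fromℕ p) n * poch (b + fromℕ i) p
  Δ-poch zero    b p i = *-comm _ _
  Δ-poch (suc n) b p i = begin
    (D i - D (suc i)) * (poch x n * (x + fromℕ n))
      ≈⟨ solve 4 (λ d e p y → (d :- e) :* (p :* y) := d :* p :* y :- e :* (p :* y))
           refl (D i) (D (suc i)) (poch x n) (x + fromℕ n) ⟩
    D i * poch x n * (x + fromℕ n) - D (suc i) * poch x (suc n)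
      ≈⟨ +-congˡ (-‿cong (*-congˡ (shift n))) ⟩
    D i * poch x n * (x + fromℕ n) - D (suc i) * (x * poch x′ n)
      ≈⟨ +-congˡ (-‿cong (solve 3 (λ d x p → d :* (x :* p) := x :* (d :* p))
           refl (D (suc i)) x (poch x′ n))) ⟩
    D i * poch x n * (x + fromℕ n) - x * (D (suc i) * poch x′ n)
      ≈⟨ +-cong (*-congʳ (Δ-poch n b p i)) (-‿cong (*-congˡ (Δ-poch n b p (suc i)))) ⟩
    q * poch x p * (x + fromℕ n) - x * (q * poch x′ p)
      ≈⟨ +-congˡ (-‿cong (solve 3 (λ x q p → x :* (q :* p) := q :* (x :* p)) refl x q (poch x′ p))) ⟩
    q * poch x p * (x + fromℕ n) - q * (x * poch x′ p)
      ≈⟨ +-congˡ (-‿cong (*-congˡ (shift p))) ⟨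
    q * poch x p * (x + fromℕ n) - q * (poch x p * (x + fromℕ p))
      ≈⟨ solve 5 (λ q w x n p → q :* w :* (x :+ n) :- q :* (w :* (x :+ p)) := q :* (:- p :+ n) :* w)
           refl q (poch x p) x (fromℕ n) (fromℕ p) ⟩
    q * (- fromℕ p + fromℕ n) * poch x p ∎
    where
    D = Δ n (λ j → poch (b + fromℕ j) p)
    x = b + fromℕ i
    x′ = b + fromℕ (suc i)
    q = poch (- fromℕ p) n
    shift : ∀ n → poch x (suc n) ≈ x * poch x′ n
    shift n = trans (poch-suc x n) (*-congˡ (poch-cong n (solve 2 (λ b i → b :+ i :+ :1 := b :+ (:1 :+ i))
         refl b (fromℕ i))))

  -- As a function of j, (-1)^l (-j)_l is the falling factorial j (j - 1) ⋯ (j - l + 1).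
  -- For l > k both sides vanish, so the truncation in k ∸ l is harmless.
  Δ-fallingFactorial : ∀ l k u →
    Δ k (λ j → poch (- fromℕ j) l * u j) 0 ≈ sgn l * poch (- fromℕ k) l * Δ (k ∸ l) u l
  Δ-fallingFactorial zero k u = begin
    Δ k (1# • u) 0            ≈⟨ Δ-• k 1# u 0 ⟩
    1# * Δ k u 0              ≈⟨ *-congʳ (*-identityˡ 1#) ⟨
    1# * 1# * Δ k u 0         ∎
  Δ-fallingFactorial (suc l) zero u = begin
    poch (- 0#) (suc l) * u 0                                  ≈⟨ *-congʳ vanish ⟩
    0# * u 0                                                   ≈⟨ solve 3 (λ x s y → :0 :* x := s :* :0 :* y)
         refl (u 0) (sgn (suc l)) (u (suc l)) ⟩
    sgn (suc l) * 0# * u (suc l)                               ≈⟨ *-congʳ (*-congˡ vanish) ⟨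
    sgn (suc l) * poch (- 0#) (suc l) * u (suc l)              ∎
    where vanish = poch-neg-vanish {0} {suc l} (ℕ.s≤s ℕ.z≤n)
  Δ-fallingFactorial (suc l) (suc k) u = begin
    Δ (suc k) (λ j → poch (- fromℕ j) (suc l) * u j) 0
      ≈⟨ Δ-cong (suc k) factor 0 ⟩
    Δ (suc k) (λ j → (0# + fromℕ j) * v j) 0
      ≈⟨ Δ-linear-factor k 0# v 0 ⟩
    (0# + 0#) * Δ (suc k) v 0 - fromℕ (suc k) * Δ k v 1
      ≈⟨ +-congˡ (-‿cong (*-congˡ tail-v)) ⟩
    (0# + 0#) * Δ (suc k) v 0 - fromℕ (suc k) * (- 1# * (sgn l * poch (- fromℕ k) l * Δ (k ∸ l) u (suc l)))
      ≈⟨ solve 5 (λ d k s p e → (:0 :+ :0) :* d :- (:1 :+ k) :* (:- :1 :* (s :* p :* e)) := :- :1 :* s :* (:- (:1 :+ k) :* p) :* e)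
           refl (Δ (suc k) v 0) (fromℕ k) (sgn l) (poch (- fromℕ k) l) (Δ (k ∸ l) u (suc l)) ⟩
    - 1# * sgn l * (- fromℕ (suc k) * poch (- fromℕ k) l) * Δ (k ∸ l) u (suc l)
      ≈⟨ *-congʳ (*-congˡ (poch-neg-suc k l)) ⟨
    sgn (suc l) * poch (- fromℕ (suc k)) (suc l) * Δ (k ∸ l) u (suc l) ∎
    where
    v : Series
    v j = - 1# * (poch (- fromℕ j + 1#) l * u j)
    factor : ∀ j → poch (- fromℕ j) (suc l) * u j ≈ (0# + fromℕ j) * v j
    factor j = trans (*-congʳ (poch-suc _ l))
      (solve 3 (λ j p u → :- j :* p :* u := (:0 :+ j) :* (:- :1 :* (p :* u)))
           refl (fromℕ j) (poch (- fromℕ j + 1#) l) (u j))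
    tail-v : Δ k v 1 ≈ - 1# * (sgn l * poch (- fromℕ k) l * Δ (k ∸ l) u (suc l))
    tail-v = begin
      Δ k v 1            ≈⟨ Δ-tail k v 0 ⟨
      Δ k (v ∘ suc) 0    ≈⟨ Δ-cong k (λ j → *-congˡ (*-congʳ (poch-cong l (solve 1 (λ j → :- (:1 :+ j) :+ :1 := :- j)
           refl (fromℕ j))))) 0 ⟩
      Δ k (- 1# • (λ j → poch (- fromℕ j) l * u (suc j))) 0   ≈⟨ Δ-• k (- 1#) _ 0 ⟩
      - 1# * Δ k (λ j → poch (- fromℕ j) l * u (suc j)) 0     ≈⟨ *-congˡ (Δ-fallingFactorial l k (u ∘ suc)) ⟩
      - 1# * (sgn l * poch (- fromℕ k) l * Δ (k ∸ l) (u ∘ suc) l)  ≈⟨ *-congˡ (*-congˡ (Δ-tail (k ∸ l) u l)) ⟩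
      - 1# * (sgn l * poch (- fromℕ k) l * Δ (k ∸ l) u (suc l))    ∎

-- The first Miller–Paris operator

module Coefficients {c ℓ₁ ℓ₂} (K : HeytingField c ℓ₁ ℓ₂) (char0 : CharacteristicZero K) where

  open MillerParis K char0
  open Arithmetic K char0
  open FiniteDifferences K char0
  open SetoidReasoning setoid

  -- The contribution of the Newton basis element (-j)_l to the k-th difference in
  -- Δ-poch-product; for l > k both sides are zero.
  Δ-poch-product-term : ∀ f p k l →
    poch (- fromℕ k) l * Δ (k ∸ l) (λ j → poch (f + fromℕ j) p) l * poch f k
      ≈ poch f p * (poch (- fromℕ k) l * poch (- fromℕ p) (k ∸ l) * poch (f + fromℕ p) l)
  Δ-poch-product-term f p k l with l ℕₚ.≤? k
  ... | no l≰k = begin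
    poch (- fromℕ k) l * d * poch f k        ≈⟨ *-congʳ (*-congʳ vanish) ⟩
    0# * d * poch f k
      ≈⟨ solve 5 (λ d y u v w → :0 :* d :* y := u :* (:0 :* v :* w)) refl
           d (poch f k) (poch f p) (poch (- fromℕ p) (k ∸ l)) (poch (f + fromℕ p) l) ⟩
    poch f p * (0# * poch (- fromℕ p) (k ∸ l) * poch (f + fromℕ p) l)
      ≈⟨ *-congˡ (*-congʳ (*-congʳ vanish)) ⟨
    poch f p * (poch (- fromℕ k) l * poch (- fromℕ p) (k ∸ l) * poch (f + fromℕ p) l) ∎
    where
    d = Δ (k ∸ l) (λ j → poch (f + fromℕ j) p) l
    vanish = poch-neg-vanish (ℕₚ.≰⇒> l≰k)
  ... | yes l≤k = begin
    q * d * poch f k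
      ≈⟨ *-congˡ (trans (reflexive (≡.cong (poch f) (≡.sym (ℕₚ.m+[n∸m]≡n l≤k)))) (poch-+ f l (k ∸ l))) ⟩
    q * d * (poch f l * poch (f + fromℕ l) (k ∸ l))
      ≈⟨ solve 4 (λ q d x y → q :* d :* (x :* y) := q :* x :* (d :* y))
           refl q d (poch f l) (poch (f + fromℕ l) (k ∸ l)) ⟩
    q * poch f l * (d * poch (f + fromℕ l) (k ∸ l))
      ≈⟨ *-congˡ (Δ-poch (k ∸ l) f p l) ⟩
    q * poch f l * (poch (- fromℕ p) (k ∸ l) * poch (f + fromℕ l) p)
      ≈⟨ solve 4 (λ q x y z → q :* x :* (y :* z) := (x :* z) :* (q :* y))
           refl q (poch f l) (poch (- fromℕ p) (k ∸ l)) (poch (f + fromℕ l) p) ⟩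
    poch f l * poch (f + fromℕ l) p * (q * poch (- fromℕ p) (k ∸ l))
      ≈⟨ *-congʳ swap ⟩
    poch f p * poch (f + fromℕ p) l * (q * poch (- fromℕ p) (k ∸ l))
      ≈⟨ solve 4 (λ x z q y → x :* z :* (q :* y) := x :* (q :* y :* z))
           refl (poch f p) (poch (f + fromℕ p) l) q (poch (- fromℕ p) (k ∸ l)) ⟩
    poch f p * (q * poch (- fromℕ p) (k ∸ l) * poch (f + fromℕ p) l) ∎
    where
    d = Δ (k ∸ l) (λ j → poch (f + fromℕ j) p) l
    q = poch (- fromℕ k) l
    swap : poch f l * poch (f + fromℕ l) p ≈ poch f p * poch (f + fromℕ p) l
    swap = trans (sym (poch-+ f l p)) (trans (reflexive (≡.cong (poch f) (ℕₚ.+-comm l p))) (poch-+ f p l))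

  -- The k-th difference at 0 of (f + j)_p h(j), for h of degree at most ω, in terms of
  -- the differences of h at 0.
  Δ-poch-product : ∀ f p {ω h} → Degree≤ ω h → ∀ k →
    Δ k (λ j → poch (f + fromℕ j) p * h j) 0 * poch f k
      ≈ poch f p * (∑[ l ≤ ω ]
          (sgn l * (poch (- fromℕ k) l * poch (- fromℕ p) (k ∸ l) * poch (f + fromℕ p) l)
            * (1/ l ! * Δ l h 0)))
  Δ-poch-product f p {ω} {h} deg k = begin
    Δ k (λ j → g j * h j) 0 * poch f k
      ≈⟨ *-congʳ (trans (Δ-cong k expand 0) (Δ-∑≤ k ω v 0)) ⟩
    (∑[ l ≤ ω ] Δ k (v l) 0) * poch f k
      ≈⟨ trans (*-comm _ _) (∑≤-*ˡ ω _ (λ l → Δ k (v l) 0)) ⟩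
    (∑[ l ≤ ω ] (poch f k * Δ k (v l) 0))
      ≈⟨ ∑≤-cong ω term ⟩
    (∑[ l ≤ ω ] (poch f p * t l))
      ≈⟨ ∑≤-*ˡ ω _ t ⟨
    poch f p * ∑≤ ω t ∎
    where
    g : Series
    g j = poch (f + fromℕ j) p
    s : ℕ → Carrier
    s l = poch (- fromℕ k) l * poch (- fromℕ p) (k ∸ l) * poch (f + fromℕ p) l
    t : ℕ → Carrier
    t l = sgn l * s l * (1/ l ! * Δ l h 0)
    v : ℕ → Series
    v l = (1/ l ! * Δ l h 0) • (λ j → poch (- fromℕ j) l * g j)
    expand : ∀ j → g j * h j ≈ ∑[ l ≤ ω ] v l j
    expand j = trans (*-congˡ (newton deg j)) (trans (∑≤-*ˡ ω (g j) (λ l → signedBinomial j l * Δ l h 0))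
      (∑≤-cong ω (λ l → solve 4 (λ g p r a → g :* (p :* r :* a) := r :* a :* (p :* g))
           refl (g j) (poch (- fromℕ j) l) (1/ l !) (Δ l h 0))))
    term : ∀ l → poch f k * Δ k (v l) 0 ≈ poch f p * t l
    term l = begin
      poch f k * Δ k (v l) 0
        ≈⟨ *-congˡ (trans (Δ-• k _ _ 0) (*-congˡ (Δ-fallingFactorial l k g))) ⟩
      poch f k * (x * (sgn l * poch (- fromℕ k) l * d))
        ≈⟨ solve 5 (λ f x s p d → f :* (x :* (s :* p :* d)) := s :* x :* (p :* d :* f))
             refl (poch f k) x (sgn l) (poch (- fromℕ k) l) d ⟩
      sgn l * x * (poch (- fromℕ k) l * d * poch f k)
        ≈⟨ *-congˡ (Δ-poch-product-term f p k l) ⟩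
      sgn l * x * (poch f p * s l)
        ≈⟨ solve 4 (λ σ x f s → σ :* x :* (f :* s) := f :* (σ :* s :* x)) refl (sgn l) x (poch f p) (s l) ⟩
      poch f p * t l ∎
      where
      x = 1/ l ! * Δ l h 0
      d = Δ (k ∸ l) g l

  -- With m = p + ω, both sides are (-m)_(ω + k - l).
  poch-exchange : ∀ p ω k {l} → l ℕ.≤ k → l ℕ.≤ ω →
    poch (- fromℕ (p ℕ.+ ω)) ω * poch (- fromℕ p) (k ∸ l)
      ≈ poch (- fromℕ (p ℕ.+ ω)) k * poch (- fromℕ (p ℕ.+ ω) + fromℕ k) (ω ∸ l)
  poch-exchange p ω k {l} l≤k l≤ω = begin
    poch μ ω * poch (- fromℕ p) (k ∸ l)       ≈⟨ *-congˡ (poch-cong (k ∸ l) μ+ω) ⟨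
    poch μ ω * poch (μ + fromℕ ω) (k ∸ l)     ≈⟨ poch-+ μ ω (k ∸ l) ⟨
    poch μ (ω ℕ.+ (k ∸ l))                    ≡⟨ ≡.cong (poch μ) index ⟩
    poch μ (k ℕ.+ (ω ∸ l))                    ≈⟨ poch-+ μ k (ω ∸ l) ⟩
    poch μ k * poch (μ + fromℕ k) (ω ∸ l)     ∎
    where
    μ = - fromℕ (p ℕ.+ ω)
    μ+ω : μ + fromℕ ω ≈ - fromℕ p
    μ+ω = trans (+-congʳ (-‿cong (fromℕ-+ p ω)))
      (solve 2 (λ p ω → :- (p :+ ω) :+ ω := :- p) refl (fromℕ p) (fromℕ ω))
    index : ω ℕ.+ (k ∸ l) ≡ k ℕ.+ (ω ∸ l)
    index = ≡.trans (≡.sym (ℕₚ.+-∸-assoc ω l≤k)) (≡.trans (≡.cong (_∸ l) (ℕₚ.+-comm ω k)) (ℕₚ.+-∸-assoc k l≤ω))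

  -- The factor (-k)_l removes the condition l ≤ k.
  poch-exchange-term : ∀ p ω k {l} → l ℕ.≤ ω →
    poch (- fromℕ (p ℕ.+ ω)) ω * (poch (- fromℕ k) l * poch (- fromℕ p) (k ∸ l))
      ≈ poch (- fromℕ (p ℕ.+ ω)) k * (poch (- fromℕ k) l * poch (- fromℕ (p ℕ.+ ω) + fromℕ k) (ω ∸ l))
  poch-exchange-term p ω k {l} l≤ω with l ℕₚ.≤? k
  ... | no l≰k = begin
    x * (poch (- fromℕ k) l * y)    ≈⟨ *-congˡ (*-congʳ vanish) ⟩
    x * (0# * y)                    ≈⟨ solve 4 (λ x y z w → x :* (:0 :* y) := z :* (:0 :* w)) refl x y z w ⟩
    z * (0# * w)                    ≈⟨ *-congˡ (*-congʳ vanish) ⟨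
    z * (poch (- fromℕ k) l * w)    ∎
    where
    vanish = poch-neg-vanish (ℕₚ.≰⇒> l≰k)
    x = poch (- fromℕ (p ℕ.+ ω)) ω
    y = poch (- fromℕ p) (k ∸ l)
    z = poch (- fromℕ (p ℕ.+ ω)) k
    w = poch (- fromℕ (p ℕ.+ ω) + fromℕ k) (ω ∸ l)
  ... | yes l≤k = trans (flip _ _ _) (trans (*-congˡ (poch-exchange p ω k l≤k l≤ω)) (sym (flip _ _ _)))
    where
    flip : ∀ x y z → x * (y * z) ≈ y * (x * z)
    flip = solve 3 (λ x y z → x :* (y :* z) := y :* (x :* z)) refl

  -- If F is H times (f + t)_p / (f)_p, the k-th difference of F at 0 is, up to the factor
  -- (-(p + ω))_k / (f)_k, the value at k of the first Miller–Paris operator with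
  -- parameters f + p and f applied to H.
  MillerParis-identity : ∀ (f : Carrier) p ω (nz : poch (f - (f + fromℕ p) - fromℕ ω) ω # 0#)
    (F H : Carrier → Carrier) → Degree≤ ω (H ∘ fromℕ) → poch f p # 0# →
    (∀ j → F (fromℕ j) * poch f p ≈ poch (f + fromℕ j) p * H (fromℕ j)) →
    ∀ k → alternatingSum F k * poch f k
            ≈ poch (- fromℕ (p ℕ.+ ω)) k * MillerParisOperator ω (f + fromℕ p) f nz H (fromℕ k)
  MillerParis-identity f p ω nz F H deg fp#0 F≈ k =
    *-cancelʳ-# nz (*-cancelʳ-# fp#0 (begin
      alternatingSum F k * poch f k * N * poch f p
        ≈⟨ *-congʳ (*-congʳ (*-congʳ (alternatingSum≈Δ F k))) ⟩
      Δ k (F ∘ fromℕ) 0 * poch f k * N * poch f p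
        ≈⟨ solve 4 (λ d x n y → d :* x :* n :* y := n :* ((y :* d) :* x))
             refl (Δ k (F ∘ fromℕ) 0) (poch f k) N (poch f p) ⟩
      N * ((poch f p * Δ k (F ∘ fromℕ) 0) * poch f k)
        ≈⟨ *-congˡ (*-congʳ (trans (sym (Δ-• k (poch f p) (F ∘ fromℕ) 0)) (Δ-cong k (λ j → trans (*-comm _ _) (F≈ j)) 0))) ⟩
      N * (Δ k (λ j → poch (f + fromℕ j) p * H (fromℕ j)) 0 * poch f k)
        ≈⟨ *-congˡ (Δ-poch-product f p deg k) ⟩
      N * (poch f p * ∑≤ ω t)
        ≈⟨ solve 3 (λ n x s → n :* (x :* s) := n :* s :* x) refl N (poch f p) (∑≤ ω t) ⟩
      N * ∑≤ ω t * poch f p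
        ≈⟨ *-congʳ (trans (∑≤-*ˡ ω N t) (trans (∑≤-cong-bounded ω term) (sym (∑≤-*ˡ ω (poch μ k) q)))) ⟩
      poch μ k * ∑≤ ω q * poch f p
        ≈⟨ *-congʳ (*-congˡ (trans (sym (*-identityʳ _)) (*-congˡ (sym (recip-inverseˡ nz))))) ⟩
      poch μ k * (∑≤ ω q * (recip nz * N)) * poch f p
        ≈⟨ *-congʳ (solve 4 (λ x s r n → x :* (s :* (r :* n)) := x :* (s :* r) :* n)
             refl (poch μ k) (∑≤ ω q) (recip nz) N) ⟩
      poch μ k * (∑≤ ω q * recip nz) * N * poch f p ∎))
    where
    μ′ = f - (f + fromℕ p) - fromℕ ω
    N = poch μ′ ω
    μ = - fromℕ (p ℕ.+ ω)
    μ′≈μ : μ′ ≈ μ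
    μ′≈μ = trans (solve 3 (λ f p ω → f :- (f :+ p) :- ω := :- (p :+ ω)) refl f (fromℕ p) (fromℕ ω))
      (-‿cong (sym (fromℕ-+ p ω)))
    A : ℕ → Carrier
    A l = Δ l (H ∘ fromℕ) 0
    t q : ℕ → Carrier
    t l = sgn l * (poch (- fromℕ k) l * poch (- fromℕ p) (k ∸ l) * poch (f + fromℕ p) l) * (1/ l ! * A l)
    q l = sgn l * poch (f + fromℕ p) l * poch (- fromℕ k) l * poch (μ′ + fromℕ k) (ω ∸ l) / l ! * alternatingSum H l
    term : ∀ l → l ℕ.≤ ω → N * t l ≈ poch μ k * q l
    term l l≤ω = begin
      N * (σ * (b * y * e) * (r * A l))
        ≈⟨ *-congʳ (poch-cong ω μ′≈μ) ⟩
      poch μ ω * (σ * (b * y * e) * (r * A l))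
        ≈⟨ solve 7 (λ n σ b y e r a → n :* (σ :* (b :* y :* e) :* (r :* a)) := σ :* (n :* (b :* y)) :* e :* r :* a)
             refl (poch μ ω) σ b y e r (A l) ⟩
      σ * (poch μ ω * (b * y)) * e * r * A l
        ≈⟨ *-congʳ (*-congʳ (*-congʳ (*-congˡ (poch-exchange-term p ω k l≤ω)))) ⟩
      σ * (poch μ k * (b * z)) * e * r * A l
        ≈⟨ solve 7 (λ σ n b z e r a → σ :* (n :* (b :* z)) :* e :* r :* a := n :* (σ :* e :* b :* z :* r :* a))
             refl σ (poch μ k) b z e r (A l) ⟩
      poch μ k * (σ * e * b * z * r * A l)
        ≈⟨ *-congˡ (*-cong (*-congʳ (*-congˡ (poch-cong (ω ∸ l) (+-congʳ (sym μ′≈μ))))) (sym (alternatingSum≈Δ H l))) ⟩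
      poch μ k * q l ∎
      where
      σ = sgn l
      b = poch (- fromℕ k) l
      y = poch (- fromℕ p) (k ∸ l)
      z = poch (μ + fromℕ k) (ω ∸ l)
      e = poch (f + fromℕ p) l
      r = 1/ l !

  -- The first factor of the product splits off: F(t) (f₁)_m₁ = (f₁ + t)_m₁ H(t), where
  -- f₁ = head f, m₁ = head ms and H is the quotient for the remaining parameters.
  pochQuotient-head : ∀ {r} (ms : Vector ℕ (suc r)) (f : Vector Carrier (suc r)) f≠ t →
    pochQuotient ms f f≠ t * poch (head f) (head ms)
      ≈ poch (head f + t) (head ms) * pochQuotient (tail ms) (tail f) (λ i → f≠ (suc i)) t
  pochQuotient-head ms f f≠ t = *-cancelʳ-# tail#0 (begin
    x * y * r * u * v         ≈⟨ solve 5 (λ x y r u v → x :* y :* r :* u :* v := x :* y :* (r :* (u :* v)))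
         refl x y r u v ⟩
    x * y * (r * (u * v))     ≈⟨ *-congˡ (recip-inverseˡ all#0) ⟩
    x * y * 1#                ≈⟨ *-congˡ (recip-inverseˡ tail#0) ⟨
    x * y * (r′ * v)          ≈⟨ solve 4 (λ x y r v → x :* y :* (r :* v) := x :* (y :* r) :* v)
         refl x y r′ v ⟩
    x * (y * r′) * v          ∎)
    where
    all#0 = product#0 (λ i → poch (f i) (ms i)) (λ i → NotNonpositiveInteger⇒poch#0 (f≠ i) (ms i))
    tail#0 = product#0 (λ i → poch (tail f i) (tail ms i)) (λ i → NotNonpositiveInteger⇒poch#0 (f≠ (suc i)) (tail ms i))
    x = poch (head f + t) (head ms)
    y = product (λ i → poch (tail f i + t) (tail ms i))
    u = poch (head f) (head ms)
    v = product (λ i → poch (tail f i) (tail ms i))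
    r = recip all#0
    r′ = recip tail#0

  -- The number ω is a variable together with an equation, as it occurs in the form
  -- total ms ∸ head ms.
  alternatingSum-pochQuotient : ∀ {r} (ms : Vector ℕ (suc r)) (f : Vector Carrier (suc r)) f≠ {ω}
    (ω≡ : ω ≡ total (tail ms)) nz k →
    alternatingSum (pochQuotient ms f f≠) k
      ≈ poch (- fromℕ (total ms)) k / poch (head f) k [ NotNonpositiveInteger⇒poch#0 (f≠ zero) k ]
        * MillerParisOperator ω (head f + fromℕ (head ms)) (head f) nz
            (pochQuotient (tail ms) (tail f) (λ i → f≠ (suc i))) (fromℕ k)
  alternatingSum-pochQuotient ms f f≠ ≡.refl nz k = *-cancelʳ-# fk#0 (begin
    alternatingSum F k * poch (head f) k
      ≈⟨ MillerParis-identity (head f) (head ms) (total (tail ms)) nz F H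
           (Degree≤-pochQuotient (tail ms) (tail f) (λ i → f≠ (suc i)))
           (NotNonpositiveInteger⇒poch#0 (f≠ zero) (head ms))
           (λ j → pochQuotient-head ms f f≠ (fromℕ j)) k ⟩
    μ * Q                                             ≈⟨ *-identityʳ _ ⟨
    μ * Q * 1#                                        ≈⟨ *-congˡ (recip-inverseˡ fk#0) ⟨
    μ * Q * (recip fk#0 * poch (head f) k)            ≈⟨ solve 4 (λ μ q r f → μ :* q :* (r :* f) := μ :* r :* q :* f)
         refl μ Q (recip fk#0) (poch (head f) k) ⟩
    μ * recip fk#0 * Q * poch (head f) k              ∎)
    where
    F = pochQuotient ms f f≠
    H = pochQuotient (tail ms) (tail f) (λ i → f≠ (suc i))
    fk#0 = NotNonpositiveInteger⇒poch#0 (f≠ zero) k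
    μ = poch (- fromℕ (total ms)) k
    Q = MillerParisOperator (total (tail ms)) (head f + fromℕ (head ms)) (head f) nz
          (pochQuotient (tail ms) (tail f) (λ i → f≠ (suc i))) (fromℕ k)

-- The ring of formal power series

module SeriesRing {c ℓ₁ ℓ₂} (K : HeytingField c ℓ₁ ℓ₂) (char0 : CharacteristicZero K) where

  open MillerParis K char0
  open Arithmetic K char0
  open SetoidReasoning setoid

  ⊝_ : Series → Series
  (⊝ s) n = - s n

  infix 8 ⊝_

  ⊛-cong : ∀ {s s′ t t′} → s ≋ s′ → t ≋ t′ → s ⊛ t ≋ s′ ⊛ t′
  ⊛-cong s≋s′ t≋t′ n = ∑≤-cong n (λ k → *-cong (s≋s′ k) (t≋t′ (n ∸ k)))

  -- The equations (s ⊛ t) 0 = s 0 * t 0 + 0# and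
  -- (s ⊛ t) (suc n) = s 0 * t (suc n) + ((s ∘ suc) ⊛ t) n hold by definition; the ring
  -- laws follow from them by induction on the index of the coefficient.
  ⊛-distribʳ-⊕ : ∀ u s t → (s ⊕ t) ⊛ u ≋ s ⊛ u ⊕ t ⊛ u
  ⊛-distribʳ-⊕ u s t zero    = solve 3 (λ u s t → (s :+ t) :* u :+ :0 := (s :* u :+ :0) :+ (t :* u :+ :0))
       refl (u 0) (s 0) (t 0)
  ⊛-distribʳ-⊕ u s t (suc n) = begin
    (s 0 + t 0) * u (suc n) + ((s ∘ suc ⊕ t ∘ suc) ⊛ u) n
      ≈⟨ +-congˡ (⊛-distribʳ-⊕ u (s ∘ suc) (t ∘ suc) n) ⟩
    (s 0 + t 0) * u (suc n) + (((s ∘ suc) ⊛ u) n + ((t ∘ suc) ⊛ u) n)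
      ≈⟨ solve 5 (λ s t u p q → (s :+ t) :* u :+ (p :+ q) := (s :* u :+ p) :+ (t :* u :+ q)) refl
           (s 0) (t 0) (u (suc n)) (((s ∘ suc) ⊛ u) n) (((t ∘ suc) ⊛ u) n) ⟩
    (s ⊛ u ⊕ t ⊛ u) (suc n) ∎

  •-⊛ : ∀ b s t → (b • s) ⊛ t ≋ b • (s ⊛ t)
  •-⊛ b s t zero    = solve 3 (λ b s t → b :* s :* t :+ :0 := b :* (s :* t :+ :0)) refl b (s 0) (t 0)
  •-⊛ b s t (suc n) = begin
    b * s 0 * t (suc n) + ((b • (s ∘ suc)) ⊛ t) n
      ≈⟨ +-congˡ (•-⊛ b (s ∘ suc) t n) ⟩
    b * s 0 * t (suc n) + b * ((s ∘ suc) ⊛ t) n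
      ≈⟨ solve 4 (λ b s t p → b :* s :* t :+ b :* p := b :* (s :* t :+ p))
           refl b (s 0) (t (suc n)) (((s ∘ suc) ⊛ t) n) ⟩
    (b • (s ⊛ t)) (suc n) ∎

  ⊛-assoc : ∀ s t u → (s ⊛ t) ⊛ u ≋ s ⊛ (t ⊛ u)
  ⊛-assoc s t u zero    = solve 3 (λ s t u → (s :* t :+ :0) :* u :+ :0 := s :* (t :* u :+ :0) :+ :0)
       refl (s 0) (t 0) (u 0)
  ⊛-assoc s t u (suc n) = begin
    (s 0 * t 0 + 0#) * u (suc n) + ((s 0 • (t ∘ suc) ⊕ (s ∘ suc) ⊛ t) ⊛ u) n
      ≈⟨ +-congˡ (⊛-distribʳ-⊕ u (s 0 • (t ∘ suc)) ((s ∘ suc) ⊛ t) n) ⟩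
    (s 0 * t 0 + 0#) * u (suc n) + (((s 0 • (t ∘ suc)) ⊛ u) n + (((s ∘ suc) ⊛ t) ⊛ u) n)
      ≈⟨ +-congˡ (+-cong (•-⊛ (s 0) (t ∘ suc) u n) (⊛-assoc (s ∘ suc) t u n)) ⟩
    (s 0 * t 0 + 0#) * u (suc n) + (s 0 * ((t ∘ suc) ⊛ u) n + ((s ∘ suc) ⊛ (t ⊛ u)) n)
      ≈⟨ solve 5 (λ s t u p q → (s :* t :+ :0) :* u :+ (s :* p :+ q) := s :* (t :* u :+ p) :+ q) refl
           (s 0) (t 0) (u (suc n)) (((t ∘ suc) ⊛ u) n) (((s ∘ suc) ⊛ (t ⊛ u)) n) ⟩
    (s ⊛ (t ⊛ u)) (suc n) ∎

  ⊛-comm : ∀ s t → s ⊛ t ≋ t ⊛ s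
  ⊛-comm s t zero          = +-congʳ (*-comm (s 0) (t 0))
  ⊛-comm s t (suc zero)    = solve 4 (λ s s′ t t′ → s :* t′ :+ (s′ :* t :+ :0) := t :* s′ :+ (t′ :* s :+ :0)) refl
    (s 0) (s 1) (t 0) (t 1)
  -- Splitting off the constant terms of both factors leaves the product of their tails.
  ⊛-comm s t (suc (suc n)) = begin
    s 0 * t (suc (suc n)) + ((s ∘ suc) ⊛ t) (suc n)
      ≈⟨ +-congˡ (⊛-comm (s ∘ suc) t (suc n)) ⟩
    s 0 * t (suc (suc n)) + (t 0 * s (suc (suc n)) + ((t ∘ suc) ⊛ (s ∘ suc)) n)
      ≈⟨ +-congˡ (+-congˡ (⊛-comm (t ∘ suc) (s ∘ suc) n)) ⟩
    s 0 * t (suc (suc n)) + (t 0 * s (suc (suc n)) + ((s ∘ suc) ⊛ (t ∘ suc)) n)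
      ≈⟨ solve 3 (λ x y z → x :+ (y :+ z) := y :+ (x :+ z)) refl
           (s 0 * t (suc (suc n))) (t 0 * s (suc (suc n))) (((s ∘ suc) ⊛ (t ∘ suc)) n) ⟩
    t 0 * s (suc (suc n)) + (s ⊛ (t ∘ suc)) (suc n)
      ≈⟨ +-congˡ (⊛-comm s (t ∘ suc) (suc n)) ⟩
    (t ⊛ s) (suc (suc n)) ∎

  𝟘-⊛ : ∀ s → 𝟘 ⊛ s ≋ 𝟘
  𝟘-⊛ s zero    = solve 1 (λ s → :0 :* s :+ :0 := :0) refl (s 0)
  𝟘-⊛ s (suc n) = trans (+-cong (zeroˡ _) (𝟘-⊛ s n)) (+-identityʳ 0#)

  𝟙-⊛ : ∀ s → 𝟙 ⊛ s ≋ s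
  𝟙-⊛ s zero    = solve 1 (λ s → :1 :* s :+ :0 := s) refl (s 0)
  𝟙-⊛ s (suc n) = trans (+-cong (*-identityˡ _) (𝟘-⊛ s n)) (+-identityʳ _)

  seriesRing : CommutativeRing c ℓ₁
  seriesRing = record
    { Carrier = Series ; _≈_ = _≋_ ; _+_ = _⊕_ ; _*_ = _⊛_ ; -_ = ⊝_ ; 0# = 𝟘 ; 1# = 𝟙
    ; isCommutativeRing = record
      { isRing = record
        { +-isAbelianGroup = record
          { isGroup = record
            { isMonoid = record
              { isSemigroup = record
                { isMagma = record
                  { isEquivalence = record
                    { refl = λ n → refl
                    ; sym = λ s≋t n → sym (s≋t n)
                    ; trans = λ s≋t t≋u n → trans (s≋t n) (t≋u n) }
                  ; ∙-cong = λ s≋s′ t≋t′ n → +-cong (s≋s′ n) (t≋t′ n) }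
                ; assoc = λ s t u n → +-assoc (s n) (t n) (u n) }
              ; identity = (λ s n → +-identityˡ (s n)) , (λ s n → +-identityʳ (s n)) }
            ; inverse = (λ s n → -‿inverseˡ (s n)) , (λ s n → -‿inverseʳ (s n))
            ; ⁻¹-cong = λ s≋t n → -‿cong (s≋t n) }
          ; comm = λ s t n → +-comm (s n) (t n) }
        ; *-cong = ⊛-cong
        ; *-assoc = ⊛-assoc
        ; *-identity = 𝟙-⊛ , (λ s n → trans (⊛-comm s 𝟙 n) (𝟙-⊛ s n))
        ; distrib = (λ u s t n → trans (⊛-comm u (s ⊕ t) n) (trans (⊛-distribʳ-⊕ u s t n)
                      (+-cong (⊛-comm s u n) (⊛-comm t u n))))
                    , ⊛-distribʳ-⊕ }
      ; *-comm = ⊛-comm } }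

-- The series x, 1 - x and x / (x - 1), and the Bernstein basis

module SeriesLemmas {c ℓ₁ ℓ₂} (K : HeytingField c ℓ₁ ℓ₂) (char0 : CharacteristicZero K) where

  open MillerParis K char0
  open Arithmetic K char0
  open SeriesRing K char0
  private
    module S = CommutativeRing seriesRing
    module SΣ = Sum S.semiring
    module SS = IntegerCoefficientSolver seriesRing
  open SetoidReasoning S.setoid
  open GroupProperties (AbelianGroup.group +-abelianGroup) using () renaming (∙-cancelˡ to +-cancelˡ)

  ⊛-congˡ : ∀ s {t t′} → t ≋ t′ → s ⊛ t ≋ s ⊛ t′
  ⊛-congˡ s t≋t′ = ⊛-cong {s} {s} (λ _ → refl) t≋t′

  ⊛-congʳ : ∀ t {s s′} → s ≋ s′ → s ⊛ t ≋ s′ ⊛ t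
  ⊛-congʳ t s≋s′ = ⊛-cong {t = t} {t} s≋s′ (λ _ → refl)

  •-congʳ : ∀ s {b b′} → b ≈ b′ → b • s ≋ b′ • s
  •-congʳ s b≈b′ n = *-congʳ b≈b′

  •-congˡ : ∀ b {s s′} → s ≋ s′ → b • s ≋ b • s′
  •-congˡ b s≋s′ n = *-congˡ (s≋s′ n)

  ⊛-• : ∀ b s t → s ⊛ (b • t) ≋ b • (s ⊛ t)
  ⊛-• b s t n = trans (⊛-comm s (b • t) n) (trans (•-⊛ b t s n) (*-congˡ (⊛-comm t s n)))

  sumˢ-cong : ∀ {n} {v w : Vector Series n} → (∀ k → v k ≋ w k) → sumˢ v ≋ sumˢ w
  sumˢ-cong {v = v} {w} v≋w = SΣ.sum-cong-≋ {x = v} {w} v≋w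

  ⊛-sumˢ : ∀ {n} s (v : Vector Series n) → s ⊛ sumˢ v ≋ sumˢ (λ k → s ⊛ v k)
  ⊛-sumˢ s v = SΣ.*-distribˡ-sum s v

  sumˢ-coefficient : ∀ {m} (v : Vector Series m) n → sumˢ v n ≡ sum (λ k → v k n)
  sumˢ-coefficient {zero}  v n = ≡.refl
  sumˢ-coefficient {suc m} v n = ≡.cong (v zero n +_) (sumˢ-coefficient (v ∘ suc) n)

  X⊛-zero : ∀ s → (X ⊛ s) 0 ≈ 0#
  X⊛-zero s = solve 1 (λ s → :0 :* s :+ :0 := :0) refl (s 0)

  X⊛-suc : ∀ s n → (X ⊛ s) (suc n) ≈ s n
  X⊛-suc s n = trans (+-cong (zeroˡ _) (trans (⊛-congʳ s tail-X n) (𝟙-⊛ s n))) (+-identityˡ _)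
    where
    tail-X : X ∘ suc ≋ 𝟙
    tail-X zero    = refl
    tail-X (suc n) = refl

  1-X≋𝟙⊕⊝X : 1-X ≋ 𝟙 ⊕ ⊝ X
  1-X≋𝟙⊕⊝X zero          = solve 0 (:1 := :1 :- :0) refl
  1-X≋𝟙⊕⊝X (suc zero)    = solve 0 (:- :1 := :0 :- :1) refl
  1-X≋𝟙⊕⊝X (suc (suc n)) = solve 0 (:0 := :0 :- :0) refl

  1-X⊛ : ∀ s → 1-X ⊛ s ≋ s ⊕ ⊝ (X ⊛ s)
  1-X⊛ s = begin
    1-X ⊛ s              ≈⟨ ⊛-congʳ s 1-X≋𝟙⊕⊝X ⟩
    (𝟙 ⊕ ⊝ X) ⊛ s        ≈⟨ SS.solve 2 (λ x s → (SS.:1 SS.:- x) SS.:* s SS.:= s SS.:- x SS.:* s)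
         S.refl X s ⟩
    s ⊕ ⊝ (X ⊛ s)        ∎

  1-X⊛-suc : ∀ s n → (1-X ⊛ s) (suc n) ≈ s (suc n) - s n
  1-X⊛-suc s n = trans (1-X⊛ s (suc n)) (+-congˡ (-‿cong (X⊛-suc s n)))

  1-X⊛-zero : ∀ s → (1-X ⊛ s) 0 ≈ s 0
  1-X⊛-zero s = trans (1-X⊛ s 0) (trans (+-congˡ (-‿cong (X⊛-zero s))) (solve 1 (λ x → x :- :0 := x)
       refl (s 0)))

  1-X⊛X/[X-1] : 1-X ⊛ X/[X-1] ≋ ⊝ X
  1-X⊛X/[X-1] zero          = trans (1-X⊛-zero X/[X-1]) (solve 0 (:0 := :- :0) refl)
  1-X⊛X/[X-1] (suc zero)    = trans (1-X⊛-suc X/[X-1] 0) (solve 0 (:- :1 :- :0 := :- :1) refl)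
  1-X⊛X/[X-1] (suc (suc n)) = trans (1-X⊛-suc X/[X-1] (suc n)) (solve 0 (:- :1 :- :- :1 := :- :0) refl)

  -- 1 - x / (x - 1) = 1 / (1 - x)
  1-X⊛[1-X/[X-1]] : 1-X ⊛ (𝟙 ⊕ ⊝ X/[X-1]) ≋ 𝟙
  1-X⊛[1-X/[X-1]] = begin
    1-X ⊛ (𝟙 ⊕ ⊝ X/[X-1])             ≈⟨ SS.solve 2 (λ u y → u SS.:* (SS.:1 SS.:- y) SS.:= u SS.:- u SS.:* y)
         S.refl 1-X X/[X-1] ⟩
    1-X ⊕ ⊝ (1-X ⊛ X/[X-1])           ≈⟨ (λ n → +-cong (1-X≋𝟙⊕⊝X n) (-‿cong (1-X⊛X/[X-1] n))) ⟩
    (𝟙 ⊕ ⊝ X) ⊕ ⊝ (⊝ X)               ≈⟨ SS.solve 1 (λ x → SS.:1 SS.:- x SS.:- (SS.:- x) SS.:= SS.:1)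
         S.refl X ⟩
    𝟙                                 ∎

  -- 1 - x is a unit, with inverse 1 - x / (x - 1).
  1-X-cancel : ∀ {s t} → 1-X ⊛ s ≋ 1-X ⊛ t → s ≋ t
  1-X-cancel {s} {t} eq = begin
    s                      ≈⟨ expand s ⟩
    G ⊛ (1-X ⊛ s)          ≈⟨ ⊛-congˡ G {1-X ⊛ s} {1-X ⊛ t} eq ⟩
    G ⊛ (1-X ⊛ t)          ≈⟨ expand t ⟨
    t                      ∎
    where
    G = 𝟙 ⊕ ⊝ X/[X-1]
    expand : ∀ s → s ≋ G ⊛ (1-X ⊛ s)
    expand s = begin
      s                    ≈⟨ 𝟙-⊛ s ⟨
      𝟙 ⊛ s                ≈⟨ ⊛-congʳ s 1-X⊛[1-X/[X-1]] ⟨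
      (1-X ⊛ G) ⊛ s        ≈⟨ SS.solve 3 (λ u g s → u SS.:* g SS.:* s SS.:= g SS.:* (u SS.:* s))
           S.refl 1-X G s ⟩
      G ⊛ (1-X ⊛ s)        ∎

  1-X^-zero : ∀ m → (1-X ^ˢ m) 0 ≈ 1#
  1-X^-zero zero    = refl
  1-X^-zero (suc m) = trans (1-X⊛-zero (1-X ^ˢ m)) (1-X^-zero m)

  1-X^-degree : ∀ m n → m ℕ.< n → (1-X ^ˢ m) n ≈ 0#
  1-X^-degree zero    (suc n) _           = refl
  1-X^-degree (suc m) (suc n) (ℕ.s≤s m<n) = trans (1-X⊛-suc (1-X ^ˢ m) n)
    (trans (+-cong (1-X^-degree m (suc n) (ℕₚ.m<n⇒m<1+n m<n)) (-‿cong (1-X^-degree m n m<n))) (-‿inverseʳ 0#))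

  -- Apart from the first, the Bernstein polynomials of degree m + 1 are x times those
  -- of degree m.
  bernstein-suc : ∀ {m} (b : Vector Carrier (suc (suc m))) →
    bernstein b ≋ b zero • 1-X ^ˢ suc m ⊕ X ⊛ bernstein (b ∘ suc)
  bernstein-suc {m} b = begin
    b zero • (𝟙 ⊛ 1-X ^ˢ suc m) ⊕ sumˢ (λ k → b (suc k) • ((X ⊛ X ^ˢ toℕ k) ⊛ 1-X ^ˢ (m ∸ toℕ k)))
      ≈⟨ (λ n → +-cong (*-congˡ (𝟙-⊛ (1-X ^ˢ suc m) n)) (sumˢ-cong term n)) ⟩
    b zero • 1-X ^ˢ suc m ⊕ sumˢ (λ k → X ⊛ t k)
      ≈⟨ (λ n → +-congˡ (⊛-sumˢ X t n)) ⟨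
    b zero • 1-X ^ˢ suc m ⊕ X ⊛ bernstein (b ∘ suc) ∎
    where
    t : Vector Series (suc m)
    t k = b (suc k) • (X ^ˢ toℕ k ⊛ 1-X ^ˢ (m ∸ toℕ k))
    term : ∀ k → b (suc k) • ((X ⊛ X ^ˢ toℕ k) ⊛ 1-X ^ˢ (m ∸ toℕ k)) ≋ X ⊛ t k
    term k = begin
      b (suc k) • ((X ⊛ X ^ˢ toℕ k) ⊛ 1-X ^ˢ (m ∸ toℕ k))
        ≈⟨ •-congˡ (b (suc k)) (⊛-assoc X (X ^ˢ toℕ k) (1-X ^ˢ (m ∸ toℕ k))) ⟩
      b (suc k) • (X ⊛ (X ^ˢ toℕ k ⊛ 1-X ^ˢ (m ∸ toℕ k)))
        ≈⟨ ⊛-• (b (suc k)) X (X ^ˢ toℕ k ⊛ 1-X ^ˢ (m ∸ toℕ k)) ⟨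
      X ⊛ t k ∎

  bernstein-zero : ∀ {m} (b : Vector Carrier (suc m)) → bernstein b 0 ≈ b zero
  bernstein-zero {zero}  b = trans (+-identityʳ _) (trans (*-congˡ (𝟙-⊛ 𝟙 0)) (*-identityʳ _))
  bernstein-zero {suc m} b = trans (bernstein-suc b 0)
    (trans (+-cong (trans (*-congˡ (1-X^-zero (suc m))) (*-identityʳ _)) (X⊛-zero (bernstein (b ∘ suc)))) (+-identityʳ _))

  bernstein-degree : ∀ {m} (b : Vector Carrier (suc m)) n → m ℕ.< n → bernstein b n ≈ 0#
  bernstein-degree {zero}  b (suc n) _   =
    trans (+-identityʳ _) (trans (*-congˡ (𝟙-⊛ 𝟙 (suc n))) (zeroʳ _))
  bernstein-degree {suc m} b (suc n) (ℕ.s≤s m<n) = trans (bernstein-suc b (suc n))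
    (trans (+-cong (trans (*-congˡ (1-X^-degree (suc m) (suc n) (ℕ.s≤s m<n))) (zeroʳ _))
                   (trans (X⊛-suc (bernstein (b ∘ suc)) n) (bernstein-degree (b ∘ suc) n m<n)))
           (+-identityʳ 0#))

  bernstein-cong : ∀ {m} (b b′ : Vector Carrier (suc m)) → (∀ k → b k ≈ b′ k) → bernstein b ≋ bernstein b′
  bernstein-cong {m} b b′ b≈b′ = sumˢ-cong (λ k → •-congʳ (X ^ˢ toℕ k ⊛ 1-X ^ˢ (m ∸ toℕ k)) (b≈b′ k))

  -- Linear independence of the Bernstein polynomials: comparing constant terms gives
  -- b₀ = b₀′, and the rest is divisible by x.
  bernstein-injective : ∀ {m} (b b′ : Vector Carrier (suc m)) → bernstein b ≋ bernstein b′ → ∀ k → b k ≈ b′ k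
  bernstein-injective {m}     b b′ eq zero    = trans (sym (bernstein-zero b)) (trans (eq 0) (bernstein-zero b′))
  bernstein-injective {suc m} b b′ eq (suc k) = bernstein-injective {m} (b ∘ suc) (b′ ∘ suc) tail-eq k
    where
    split : ∀ (b : Vector Carrier (suc (suc m))) n → bernstein b (suc n) ≈ b zero * (1-X ^ˢ suc m) (suc n) + bernstein (b ∘ suc) n
    split b n = trans (bernstein-suc b (suc n)) (+-congˡ (X⊛-suc (bernstein (b ∘ suc)) n))
    tail-eq : bernstein (b ∘ suc) ≋ bernstein (b′ ∘ suc)
    tail-eq n = +-cancelˡ _ _ _
      (trans (sym (split b n)) (trans (eq (suc n)) (trans (split b′ n)
        (+-congʳ (*-congʳ (sym (bernstein-injective b b′ eq zero)))))))

  -- As (1 - x) Y = - x for Y = x / (x - 1), each factor Y uses up one factor 1 - x.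
  1-X^⊛X/[X-1]^ : ∀ m k → k ℕ.≤ m →
    1-X ^ˢ m ⊛ X/[X-1] ^ˢ k ≋ sgn k • (X ^ˢ k ⊛ 1-X ^ˢ (m ∸ k))
  1-X^⊛X/[X-1]^ m zero _ n = trans (⊛-comm (1-X ^ˢ m) 𝟙 n) (sym (*-identityˡ _))
  1-X^⊛X/[X-1]^ (suc m) (suc k) (ℕ.s≤s k≤m) = begin
    (1-X ⊛ u) ⊛ (X/[X-1] ⊛ y)
      ≈⟨ SS.solve 4 (λ p u q y → (p SS.:* u) SS.:* (q SS.:* y) SS.:= (p SS.:* q) SS.:* (u SS.:* y))
           S.refl 1-X u X/[X-1] y ⟩
    (1-X ⊛ X/[X-1]) ⊛ (u ⊛ y)
      ≈⟨ ⊛-cong {1-X ⊛ X/[X-1]} {⊝ X} {u ⊛ y} {sgn k • (X ^ˢ k ⊛ v)} 1-X⊛X/[X-1] (1-X^⊛X/[X-1]^ m k k≤m) ⟩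
    ⊝ X ⊛ (sgn k • (X ^ˢ k ⊛ v))
      ≈⟨ ⊛-• (sgn k) (⊝ X) (X ^ˢ k ⊛ v) ⟩
    sgn k • (⊝ X ⊛ (X ^ˢ k ⊛ v))
      ≈⟨ •-congˡ (sgn k) (SS.solve 3 (λ x y v → SS.:- x SS.:* (y SS.:* v) SS.:= SS.:- ((x SS.:* y) SS.:* v))
           S.refl X (X ^ˢ k) v) ⟩
    sgn k • (⊝ ((X ⊛ X ^ˢ k) ⊛ v))
      ≈⟨ (λ n → solve 2 (λ s x → s :* :- x := :- :1 :* s :* x) refl (sgn k) (((X ⊛ X ^ˢ k) ⊛ v) n)) ⟩
    sgn (suc k) • ((X ⊛ X ^ˢ k) ⊛ v) ∎
    where
    u = 1-X ^ˢ m
    v = 1-X ^ˢ (m ∸ k)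
    y = X/[X-1] ^ˢ k

  -- (1 - x)^m p(x / (x - 1)) has the Bernstein coefficients (-1)^k p_k.
  bernstein-sgn : ∀ {m} (p : Poly m) →
    bernstein (λ k → sgn (toℕ k) * p k) ≋ 1-X ^ˢ m ⊛ p ⟪ X/[X-1] ⟫
  bernstein-sgn {m} p = begin
    bernstein (λ k → sgn (toℕ k) * p k)
      ≈⟨ sumˢ-cong term ⟩
    sumˢ (λ k → 1-X ^ˢ m ⊛ (p k • X/[X-1] ^ˢ toℕ k))
      ≈⟨ ⊛-sumˢ (1-X ^ˢ m) (λ k → p k • X/[X-1] ^ˢ toℕ k) ⟨
    1-X ^ˢ m ⊛ p ⟪ X/[X-1] ⟫ ∎
    where
    term : ∀ k → (sgn (toℕ k) * p k) • (X ^ˢ toℕ k ⊛ 1-X ^ˢ (m ∸ toℕ k)) ≋ 1-X ^ˢ m ⊛ (p k • X/[X-1] ^ˢ toℕ k)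
    term k = begin
      (sgn (toℕ k) * p k) • t
        ≈⟨ (λ n → solve 3 (λ s p t → s :* p :* t := p :* (s :* t)) refl (sgn (toℕ k)) (p k) (t n)) ⟩
      p k • (sgn (toℕ k) • t)
        ≈⟨ •-congˡ (p k) (1-X^⊛X/[X-1]^ m (toℕ k) (Finₚ.toℕ≤pred[n] k)) ⟨
      p k • (1-X ^ˢ m ⊛ X/[X-1] ^ˢ toℕ k)
        ≈⟨ ⊛-• (p k) (1-X ^ˢ m) (X/[X-1] ^ˢ toℕ k) ⟨
      1-X ^ˢ m ⊛ (p k • X/[X-1] ^ˢ toℕ k) ∎
      where t = X ^ˢ toℕ k ⊛ 1-X ^ˢ (m ∸ toℕ k)

  -- Horner's scheme.
  ⟪⟫-suc : ∀ {m} (p : Poly (suc m)) s → p ⟪ s ⟫ ≋ p zero • 𝟙 ⊕ s ⊛ ((p ∘ suc) ⟪ s ⟫)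
  ⟪⟫-suc p s n = +-congˡ (trans (sumˢ-cong (λ k n → sym (⊛-• (p (suc k)) s (s ^ˢ toℕ k) n)) n)
    (sym (⊛-sumˢ s (λ k → p (suc k) • s ^ˢ toℕ k) n)))

  -- A series without terms of degree above m is the polynomial of its coefficients.
  truncate : ∀ m s → (∀ n → m ℕ.< n → s n ≈ 0#) → _⟪_⟫ {m} (s ∘ toℕ) X ≋ s
  truncate zero    s s≈0 zero    = trans (+-identityʳ _) (*-identityʳ _)
  truncate zero    s s≈0 (suc n) = trans (+-identityʳ _) (trans (zeroʳ _) (sym (s≈0 (suc n) (ℕ.s≤s ℕ.z≤n))))
  truncate (suc m) s s≈0 zero    = trans (⟪⟫-suc {m} (s ∘ toℕ) X 0)
    (trans (+-cong (*-identityʳ _) (X⊛-zero (_⟪_⟫ {m} (s ∘ suc ∘ toℕ) X))) (+-identityʳ _))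
  truncate (suc m) s s≈0 (suc n) = trans (⟪⟫-suc {m} (s ∘ toℕ) X (suc n))
    (trans (+-cong (zeroʳ _) (trans (X⊛-suc (_⟪_⟫ {m} (s ∘ suc ∘ toℕ) X) n)
             (truncate m (s ∘ suc) (λ n m<n → s≈0 (suc n) (ℕ.s≤s m<n)) n)))
           (+-identityˡ _))

-- The substitution of x / (x - 1) for x

module EulerTransform {c ℓ₁ ℓ₂} (K : HeytingField c ℓ₁ ℓ₂) (char0 : CharacteristicZero K) where

  open MillerParis K char0
  open Arithmetic K char0
  open FiniteDifferences K char0
  open SeriesRing K char0
  open SeriesLemmas K char0
  private
    module S = CommutativeRing seriesRing
    module SS = IntegerCoefficientSolver seriesRing
  open SetoidReasoning S.setoid

  -- The coefficients of s(x / (x - 1)).  For n ≥ 0 the coefficient of x^(n + 1) in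
  -- (x / (x - 1))^k, k ≥ 1, is (-1)^k times the binomial coefficient of n and k - 1, so
  -- the sum over k is minus the n-th difference at 0 of the sequence s 1, s 2, ….
  euler : Series → Series
  euler s zero    = s 0
  euler s (suc n) = - Δ n (s ∘ suc) 0

  euler-cong : ∀ {s t} → s ≋ t → euler s ≋ euler t
  euler-cong s≋t zero    = s≋t 0
  euler-cong s≋t (suc n) = -‿cong (Δ-cong n (s≋t ∘ suc) 0)

  euler-⊕ : ∀ s t → euler (s ⊕ t) ≋ euler s ⊕ euler t
  euler-⊕ s t zero    = refl
  euler-⊕ s t (suc n) = trans (-‿cong (Δ-⊕ n (s ∘ suc) (t ∘ suc) 0))
    (solve 2 (λ x y → :- (x :+ y) := :- x :+ :- y) refl (Δ n (s ∘ suc) 0) (Δ n (t ∘ suc) 0))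

  euler-• : ∀ b s → euler (b • s) ≋ b • euler s
  euler-• b s zero    = refl
  euler-• b s (suc n) = trans (-‿cong (Δ-• n b (s ∘ suc) 0))
    (solve 2 (λ b x → :- (b :* x) := b :* :- x) refl b (Δ n (s ∘ suc) 0))

  euler-𝟘 : euler 𝟘 ≋ 𝟘
  euler-𝟘 zero    = refl
  euler-𝟘 (suc n) = trans (-‿cong (Δ-𝟘 n 0)) (solve 0 (:- :0 := :0) refl)

  euler-𝟙 : euler 𝟙 ≋ 𝟙
  euler-𝟙 zero    = refl
  euler-𝟙 (suc n) = euler-𝟘 (suc n)

  euler-involutive : ∀ s → euler (euler s) ≋ s
  euler-involutive s zero    = refl
  euler-involutive s (suc n) = trans
    (-‿cong (trans (Δ-cong n (λ l → solve 1 (λ x → :- x := :- :1 :* x) refl (Δ l (s ∘ suc) 0)) 0)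
            (trans (Δ-• n (- 1#) (λ l → Δ l (s ∘ suc) 0) 0) (*-congˡ (Δ-involutive n (s ∘ suc))))))
    (solve 1 (λ x → :- (:- :1 :* x) := x) refl (s (suc n)))

  -- The coefficients of euler (X ⊛ s) are differences of s at 0, and two consecutive
  -- ones differ by a difference of s at 1.
  1-X⊛euler-X⊛ : ∀ s → 1-X ⊛ euler (X ⊛ s) ≋ ⊝ X ⊛ euler s
  1-X⊛euler-X⊛ s n = trans (coefficients n)
    (sym (SS.solve 2 (λ x s → SS.:- x SS.:* s SS.:= SS.:- (x SS.:* s)) S.refl X (euler s) n))
    where
    euler-X⊛ : ∀ n → euler (X ⊛ s) (suc n) ≈ - Δ n s 0
    euler-X⊛ n = -‿cong (Δ-cong n (X⊛-suc s) 0)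
    coefficients : 1-X ⊛ euler (X ⊛ s) ≋ ⊝ (X ⊛ euler s)
    coefficients zero          = trans (1-X⊛-zero (euler (X ⊛ s))) (trans (X⊛-zero s)
      (trans (solve 0 (:0 := :- :0) refl) (-‿cong (sym (X⊛-zero (euler s))))))
    coefficients (suc zero)    = trans (1-X⊛-suc (euler (X ⊛ s)) 0)
      (trans (+-cong (euler-X⊛ 0) (-‿cong (X⊛-zero s)))
      (trans (solve 1 (λ x → :- x :- :0 := :- x) refl (s 0)) (-‿cong (sym (X⊛-suc (euler s) 0)))))
    coefficients (suc (suc n)) = trans (1-X⊛-suc (euler (X ⊛ s)) (suc n))
      (trans (+-cong (euler-X⊛ (suc n)) (-‿cong (euler-X⊛ n)))
      (trans (solve 2 (λ x y → :- (x :- y) :- :- x := :- :- y) refl (Δ n s 0) (Δ n s 1))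
      (-‿cong (trans (-‿cong (sym (Δ-tail n s 0))) (sym (X⊛-suc (euler s) (suc n)))))))

  euler-X⊛ : ∀ s → euler (X ⊛ s) ≋ X/[X-1] ⊛ euler s
  euler-X⊛ s = 1-X-cancel {euler (X ⊛ s)} {X/[X-1] ⊛ euler s} (begin
    1-X ⊛ euler (X ⊛ s)             ≈⟨ 1-X⊛euler-X⊛ s ⟩
    ⊝ X ⊛ euler s                   ≈⟨ ⊛-congʳ (euler s) 1-X⊛X/[X-1] ⟨
    (1-X ⊛ X/[X-1]) ⊛ euler s       ≈⟨ ⊛-assoc 1-X X/[X-1] (euler s) ⟩
    1-X ⊛ (X/[X-1] ⊛ euler s)       ∎)

  -- The substitution maps 1 - x to its inverse.
  1-X⊛euler-1-X⊛ : ∀ s → 1-X ⊛ euler (1-X ⊛ s) ≋ euler s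
  1-X⊛euler-1-X⊛ s = begin
    1-X ⊛ euler (1-X ⊛ s)
      ≈⟨ ⊛-congˡ 1-X (euler-cong {1-X ⊛ s} expand) ⟩
    1-X ⊛ euler (s ⊕ - 1# • (X ⊛ s))
      ≈⟨ ⊛-congˡ 1-X (euler-⊕ s (- 1# • (X ⊛ s))) ⟩
    1-X ⊛ (euler s ⊕ euler (- 1# • (X ⊛ s)))
      ≈⟨ ⊛-congˡ 1-X (λ n → +-congˡ (euler-• (- 1#) (X ⊛ s) n)) ⟩
    1-X ⊛ (euler s ⊕ - 1# • euler (X ⊛ s))
      ≈⟨ ⊛-congˡ 1-X (λ n → +-congˡ (trans (solve 1 (λ x → :- :1 :* x := :- x)
           refl (euler (X ⊛ s) n)) (-‿cong (euler-X⊛ s n)))) ⟩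
    1-X ⊛ (euler s ⊕ ⊝ (X/[X-1] ⊛ euler s))
      ≈⟨ SS.solve 3 (λ u y s → u SS.:* (s SS.:- y SS.:* s) SS.:= (u SS.:* (SS.:1 SS.:- y)) SS.:* s)
           S.refl 1-X X/[X-1] (euler s) ⟩
    (1-X ⊛ (𝟙 ⊕ ⊝ X/[X-1])) ⊛ euler s
      ≈⟨ ⊛-congʳ (euler s) 1-X⊛[1-X/[X-1]] ⟩
    𝟙 ⊛ euler s
      ≈⟨ 𝟙-⊛ (euler s) ⟩
    euler s ∎
    where
    expand : 1-X ⊛ s ≋ s ⊕ - 1# • (X ⊛ s)
    expand n = trans (1-X⊛ s n) (+-congˡ (solve 1 (λ x → :- x := :- :1 :* x) refl ((X ⊛ s) n)))

  1-X^⊛euler-1-X^⊛ : ∀ m s → 1-X ^ˢ m ⊛ euler (1-X ^ˢ m ⊛ s) ≋ euler s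
  1-X^⊛euler-1-X^⊛ zero    s n = trans (𝟙-⊛ (euler (𝟙 ⊛ s)) n) (euler-cong (𝟙-⊛ s) n)
  1-X^⊛euler-1-X^⊛ (suc m) s = begin
    (1-X ⊛ u) ⊛ euler ((1-X ⊛ u) ⊛ s)
      ≈⟨ ⊛-congˡ (1-X ⊛ u) (euler-cong (⊛-assoc 1-X u s)) ⟩
    (1-X ⊛ u) ⊛ euler (1-X ⊛ (u ⊛ s))
      ≈⟨ SS.solve 3 (λ x u e → (x SS.:* u) SS.:* e SS.:= u SS.:* (x SS.:* e))
           S.refl 1-X u (euler (1-X ⊛ (u ⊛ s))) ⟩
    u ⊛ (1-X ⊛ euler (1-X ⊛ (u ⊛ s)))
      ≈⟨ ⊛-congˡ u (1-X⊛euler-1-X⊛ (u ⊛ s)) ⟩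
    u ⊛ euler (u ⊛ s)
      ≈⟨ 1-X^⊛euler-1-X^⊛ m s ⟩
    euler s ∎
    where u = 1-X ^ˢ m

  euler-X^ : ∀ k → euler (X ^ˢ k) ≋ X/[X-1] ^ˢ k
  euler-X^ zero    = euler-𝟙
  euler-X^ (suc k) n = trans (euler-X⊛ (X ^ˢ k) n) (⊛-congˡ X/[X-1] (euler-X^ k) n)

  euler-sumˢ : ∀ {m} (v : Vector Series m) → euler (sumˢ v) ≋ sumˢ (λ k → euler (v k))
  euler-sumˢ {zero}  v   = euler-𝟘
  euler-sumˢ {suc m} v n = trans (euler-⊕ (v zero) (sumˢ (v ∘ suc)) n) (+-congˡ (euler-sumˢ (v ∘ suc) n))

  euler-⟪X⟫ : ∀ {m} (p : Poly m) → euler (p ⟪ X ⟫) ≋ p ⟪ X/[X-1] ⟫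
  euler-⟪X⟫ p n = trans (euler-sumˢ (λ k → p k • X ^ˢ toℕ k) n)
    (sumˢ-cong (λ k n → trans (euler-• (p k) (X ^ˢ toℕ k) n) (*-congˡ (euler-X^ (toℕ k) n))) n)

  -- The substitution of x / (x - 1) for x, applied to the hypothesis.
  homogeneous-involution : ∀ {m} (p q : Poly m) →
    p ⟪ X ⟫ ≋ 1-X ^ˢ m ⊛ q ⟪ X/[X-1] ⟫ → q ⟪ X ⟫ ≋ 1-X ^ˢ m ⊛ p ⟪ X/[X-1] ⟫
  homogeneous-involution {m} p q eq = begin
    q ⟪ X ⟫                                              ≈⟨ euler-involutive (q ⟪ X ⟫) ⟨
    euler (euler (q ⟪ X ⟫))                              ≈⟨ euler-cong (euler-⟪X⟫ q) ⟩
    euler (q ⟪ X/[X-1] ⟫)                                ≈⟨ 1-X^⊛euler-1-X^⊛ m (q ⟪ X/[X-1] ⟫) ⟨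
    1-X ^ˢ m ⊛ euler (1-X ^ˢ m ⊛ q ⟪ X/[X-1] ⟫)          ≈⟨ ⊛-congˡ (1-X ^ˢ m) (euler-cong eq) ⟨
    1-X ^ˢ m ⊛ euler (p ⟪ X ⟫)                           ≈⟨ ⊛-congˡ (1-X ^ˢ m) (euler-⟪X⟫ p) ⟩
    1-X ^ˢ m ⊛ p ⟪ X/[X-1] ⟫                             ∎

-- Binomial series and the polynomial w

module BinomialSeries {c ℓ₁ ℓ₂} (K : HeytingField c ℓ₁ ℓ₂) (char0 : CharacteristicZero K) where

  open MillerParis K char0
  open Arithmetic K char0
  open FiniteDifferences K char0
  open SeriesRing K char0
  open SeriesLemmas K char0
  private
    module S = CommutativeRing seriesRing
    module SS = IntegerCoefficientSolver seriesRing

  -- (1 - x)^(-b), so that [1-X]^ α is binom (- α) by definition.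
  binom : Carrier → Series
  binom b n = poch b n / n !

  binom-cong : ∀ {b b′} → b ≈ b′ → binom b ≋ binom b′
  binom-cong b≈b′ n = *-congʳ (poch-cong n b≈b′)

  -- The derivation x d/dx.
  θ : Series → Series
  θ s n = fromℕ n * s n

  module _ where
    open SetoidReasoning setoid

    θ-⊛ : ∀ s t → θ (s ⊛ t) ≋ θ s ⊛ t ⊕ s ⊛ θ t
    θ-⊛ s t zero    = solve 2 (λ s t → :0 :* (s :* t :+ :0) := (:0 :* s :* t :+ :0) :+ (s :* (:0 :* t) :+ :0))
         refl (s 0) (t 0)
    θ-⊛ s t (suc n) = begin
      fromℕ (suc n) * (s 0 * t (suc n) + (s′ ⊛ t) n)
        ≈⟨ solve 4 (λ n s t p → (:1 :+ n) :* (s :* t :+ p) := s :* ((:1 :+ n) :* t) :+ n :* p :+ p)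
             refl (fromℕ n) (s 0) (t (suc n)) ((s′ ⊛ t) n) ⟩
      s 0 * θ t (suc n) + θ (s′ ⊛ t) n + (s′ ⊛ t) n
        ≈⟨ +-congʳ (+-congˡ (θ-⊛ s′ t n)) ⟩
      s 0 * θ t (suc n) + ((θ s′ ⊛ t) n + (s′ ⊛ θ t) n) + (s′ ⊛ t) n
        ≈⟨ solve 6 (λ s t′ t p q r → s :* t′ :+ (p :+ q) :+ r := (:0 :* s :* t :+ (r :+ p)) :+ (s :* t′ :+ q)) refl
             (s 0) (θ t (suc n)) (t (suc n)) ((θ s′ ⊛ t) n) ((s′ ⊛ θ t) n) ((s′ ⊛ t) n) ⟩
      (0# * s 0 * t (suc n) + ((s′ ⊛ t) n + (θ s′ ⊛ t) n)) + (s ⊛ θ t) (suc n)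
        ≈⟨ +-congʳ (+-congˡ (trans (sym (⊛-distribʳ-⊕ t s′ (θ s′) n)) (⊛-congʳ t tail-θ n))) ⟩
      (θ s ⊛ t) (suc n) + (s ⊛ θ t) (suc n) ∎
      where
      s′ = s ∘ suc
      tail-θ : s′ ⊕ θ s′ ≋ θ s ∘ suc
      tail-θ k = solve 2 (λ k s → s :+ k :* s := (:1 :+ k) :* s) refl (fromℕ k) (s′ k)

    θ-binom : ∀ b → θ (binom b) ≋ b • (X ⊛ binom (b + 1#))
    θ-binom b zero    = trans (zeroˡ _) (sym (trans (*-congˡ (X⊛-zero (binom (b + 1#)))) (zeroʳ b)))
    θ-binom b (suc n) = begin
      fromℕ (suc n) * (poch b (suc n) * 1/ suc n !)
        ≈⟨ *-congˡ (*-congʳ (poch-suc b n)) ⟩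
      fromℕ (suc n) * (b * poch (b + 1#) n * 1/ suc n !)
        ≈⟨ solve 4 (λ n b p r → n :* (b :* p :* r) := b :* (p :* (n :* r)))
             refl (fromℕ (suc n)) b (poch (b + 1#) n) (1/ suc n !) ⟩
      b * (poch (b + 1#) n * (fromℕ (suc n) * 1/ suc n !))
        ≈⟨ *-congˡ (*-congˡ (1/suc! n)) ⟨
      b * binom (b + 1#) n
        ≈⟨ *-congˡ (X⊛-suc (binom (b + 1#)) n) ⟨
      b * (X ⊛ binom (b + 1#)) (suc n) ∎

    -- Both sides have the same image under θ, by induction on the index of the
    -- coefficient for all b and d at once; the coefficients of index suc n are then
    -- equal because fromℕ (suc n) is invertible.
    binom-⊛ : ∀ b d → binom b ⊛ binom d ≋ binom (b + d)
    binom-⊛ b d zero    = begin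
      1# * 1/ 0 ! * (1# * 1/ 0 !) + 0#    ≈⟨ solve 1 (λ r → :1 :* r :* (:1 :* r) :+ :0 := r :* (:1 :* r))
           refl (1/ 0 !) ⟩
      1/ 0 ! * (1# * 1/ 0 !)              ≈⟨ *-congʳ 1/0! ⟩
      1# * (1# * 1/ 0 !)                  ≈⟨ *-identityˡ _ ⟩
      1# * 1/ 0 !                         ∎
    binom-⊛ b d (suc n) = *-cancelʳ-# (char0 (suc n)) (begin
      (binom b ⊛ binom d) (suc n) * fromℕ (suc n)
        ≈⟨ *-comm _ _ ⟩
      θ (binom b ⊛ binom d) (suc n)
        ≈⟨ θ-⊛ (binom b) (binom d) (suc n) ⟩
      (θ (binom b) ⊛ binom d) (suc n) + (binom b ⊛ θ (binom d)) (suc n)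
        ≈⟨ +-cong left right ⟩
      b * binom (b + d + 1#) n + d * binom (b + d + 1#) n
        ≈⟨ distribʳ _ b d ⟨
      (b + d) * binom (b + d + 1#) n
        ≈⟨ *-congˡ (X⊛-suc (binom (b + d + 1#)) n) ⟨
      (b + d) * (X ⊛ binom (b + d + 1#)) (suc n)
        ≈⟨ θ-binom (b + d) (suc n) ⟨
      θ (binom (b + d)) (suc n)
        ≈⟨ *-comm _ _ ⟩
      binom (b + d) (suc n) * fromℕ (suc n) ∎)
      where
      left : (θ (binom b) ⊛ binom d) (suc n) ≈ b * binom (b + d + 1#) n
      left = begin
        (θ (binom b) ⊛ binom d) (suc n)
          ≈⟨ ⊛-congʳ (binom d) (θ-binom b) (suc n) ⟩
        ((b • (X ⊛ binom (b + 1#))) ⊛ binom d) (suc n)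
          ≈⟨ •-⊛ b (X ⊛ binom (b + 1#)) (binom d) (suc n) ⟩
        b * ((X ⊛ binom (b + 1#)) ⊛ binom d) (suc n)
          ≈⟨ *-congˡ (⊛-assoc X (binom (b + 1#)) (binom d) (suc n)) ⟩
        b * (X ⊛ (binom (b + 1#) ⊛ binom d)) (suc n)
          ≈⟨ *-congˡ (X⊛-suc (binom (b + 1#) ⊛ binom d) n) ⟩
        b * (binom (b + 1#) ⊛ binom d) n
          ≈⟨ *-congˡ (binom-⊛ (b + 1#) d n) ⟩
        b * binom (b + 1# + d) n
          ≈⟨ *-congˡ (binom-cong (solve 2 (λ b d → b :+ :1 :+ d := b :+ d :+ :1) refl b d) n) ⟩
        b * binom (b + d + 1#) n ∎
      right : (binom b ⊛ θ (binom d)) (suc n) ≈ d * binom (b + d + 1#) n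
      right = begin
        (binom b ⊛ θ (binom d)) (suc n)
          ≈⟨ ⊛-congˡ (binom b) (θ-binom d) (suc n) ⟩
        (binom b ⊛ (d • (X ⊛ binom (d + 1#)))) (suc n)
          ≈⟨ ⊛-• d (binom b) (X ⊛ binom (d + 1#)) (suc n) ⟩
        d * (binom b ⊛ (X ⊛ binom (d + 1#))) (suc n)
          ≈⟨ *-congˡ (SS.solve 3 (λ x y z → x SS.:* (y SS.:* z) SS.:= y SS.:* (x SS.:* z))
               S.refl (binom b) X (binom (d + 1#)) (suc n)) ⟩
        d * (X ⊛ (binom b ⊛ binom (d + 1#))) (suc n)
          ≈⟨ *-congˡ (X⊛-suc (binom b ⊛ binom (d + 1#)) n) ⟩
        d * (binom b ⊛ binom (d + 1#)) n
          ≈⟨ *-congˡ (binom-⊛ b (d + 1#) n) ⟩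
        d * binom (b + (d + 1#)) n
          ≈⟨ *-congˡ (binom-cong (sym (+-assoc b d 1#)) n) ⟩
        d * binom (b + d + 1#) n ∎

    binom-0 : binom 0# ≋ 𝟙
    binom-0 zero    = trans (*-identityˡ _) 1/0!
    binom-0 (suc n) = trans (*-congʳ (trans (poch-suc 0# n) (zeroˡ _))) (zeroˡ _)

    binom-neg1 : binom (- 1#) ≋ 1-X
    binom-neg1 zero          = trans (*-identityˡ _) 1/0!
    binom-neg1 (suc zero)    = begin
      1# * (- 1# + 0#) * 1/ 1 !      ≈⟨ solve 1 (λ r → :1 :* (:- :1 :+ :0) :* r := :- ((:1 :+ :0) :* r))
           refl (1/ 1 !) ⟩
      - (fromℕ 1 * 1/ 1 !)           ≈⟨ -‿cong (1/suc! 0) ⟨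
      - 1/ 0 !                       ≈⟨ -‿cong 1/0! ⟩
      - 1#                           ∎
    binom-neg1 (suc (suc n)) = trans (*-congʳ (trans (poch-suc (- 1#) (suc n)) (trans (*-congˡ
      (trans (poch-suc (- 1# + 1#) n) (trans (*-congʳ (-‿inverseˡ 1#)) (zeroˡ _)))) (zeroʳ _)))) (zeroˡ _)

  [1-X]^-cong : ∀ {α β} → α ≈ β → [1-X]^ α ≋ [1-X]^ β
  [1-X]^-cong α≈β = binom-cong (-‿cong α≈β)

  [1-X]^-+ : ∀ α β → [1-X]^ α ⊛ [1-X]^ β ≋ [1-X]^ (α + β)
  [1-X]^-+ α β n = trans (binom-⊛ (- α) (- β) n)
    (binom-cong (solve 2 (λ α β → :- α :+ :- β := :- (α :+ β)) refl α β) n)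

  [1-X]^0 : [1-X]^ 0# ≋ 𝟙
  [1-X]^0 n = trans (binom-cong (solve 0 (:- :0 := :0) refl) n) (binom-0 n)

  [1-X]^-inverse : ∀ α → [1-X]^ α ⊛ [1-X]^ (- α) ≋ 𝟙
  [1-X]^-inverse α n = trans ([1-X]^-+ α (- α) n)
    (trans ([1-X]^-cong (-‿inverseʳ α) n) ([1-X]^0 n))

  open SetoidReasoning S.setoid

  [1-X]^fromℕ : ∀ m → [1-X]^ fromℕ m ≋ 1-X ^ˢ m
  [1-X]^fromℕ zero    = [1-X]^0
  [1-X]^fromℕ (suc m) = begin
    [1-X]^ (1# + fromℕ m)         ≈⟨ [1-X]^-+ 1# (fromℕ m) ⟨
    [1-X]^ 1# ⊛ [1-X]^ fromℕ m    ≈⟨ ⊛-cong {[1-X]^ 1#} {1-X} {[1-X]^ fromℕ m} {1-X ^ˢ m} binom-neg1 ([1-X]^fromℕ m) ⟩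
    1-X ⊛ 1-X ^ˢ m                ∎

  -- The sum over n of (-n)_l (a)_n x^n / n!.
  fallingSeries : Carrier → ℕ → Series
  fallingSeries a l n = poch (- fromℕ n) l * binom a n

  fallingSeries-suc : ∀ a l → fallingSeries a (suc l) ≋ - a • (X ⊛ fallingSeries (a + 1#) l)
  fallingSeries-suc a l zero    = trans (*-congʳ (poch-neg-vanish {0} {suc l} (ℕ.s≤s ℕ.z≤n)))
    (trans (zeroˡ _) (sym (trans (*-congˡ (X⊛-zero (fallingSeries (a + 1#) l))) (zeroʳ _))))
  fallingSeries-suc a l (suc n) = trans (*-cong (poch-neg-suc n l) (*-congʳ (poch-suc a n)))
    (trans (solve 5 (λ n p a q r → :- n :* p :* (a :* q :* r) := :- a :* (p :* (q :* (n :* r)))) refl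
              (fromℕ (suc n)) (poch (- fromℕ n) l) a (poch (a + 1#) n) (1/ suc n !))
           (*-congˡ (trans (*-congˡ (*-congˡ (sym (1/suc! n)))) (sym (X⊛-suc (fallingSeries (a + 1#) l) n)))))

  [1-X]^⊛fallingSeries : ∀ a l → [1-X]^ a ⊛ fallingSeries a l ≋ poch a l • X/[X-1] ^ˢ l
  [1-X]^⊛fallingSeries a zero = begin
    [1-X]^ a ⊛ fallingSeries a 0     ≈⟨ ⊛-congˡ ([1-X]^ a) (λ n → *-identityˡ (binom a n)) ⟩
    [1-X]^ a ⊛ binom a               ≈⟨ binom-⊛ (- a) a ⟩
    binom (- a + a)                  ≈⟨ binom-cong (-‿inverseˡ a) ⟩
    binom 0#                         ≈⟨ binom-0 ⟩
    𝟙                                ≈⟨ (λ n → *-identityˡ (𝟙 n)) ⟨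
    1# • 𝟙                           ∎
  [1-X]^⊛fallingSeries a (suc l) = begin
    A ⊛ fallingSeries a (suc l)
      ≈⟨ ⊛-congˡ A (fallingSeries-suc a l) ⟩
    A ⊛ (- a • (X ⊛ W))
      ≈⟨ ⊛-• (- a) A (X ⊛ W) ⟩
    - a • (A ⊛ (X ⊛ W))
      ≈⟨ (λ n → solve 2 (λ a x → :- a :* x := a :* :- x) refl a ((A ⊛ (X ⊛ W)) n)) ⟩
    a • (⊝ (A ⊛ (X ⊛ W)))
      ≈⟨ •-congˡ a (SS.solve 3 (λ p x w → SS.:- (p SS.:* (x SS.:* w)) SS.:= (p SS.:* SS.:- x) SS.:* w)
           S.refl A X W) ⟩
    a • ((A ⊛ ⊝ X) ⊛ W)
      ≈⟨ •-congˡ a (⊛-congʳ W (⊛-congˡ A 1-X⊛X/[X-1])) ⟨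
    a • ((A ⊛ (1-X ⊛ Y)) ⊛ W)
      ≈⟨ •-congˡ a (SS.solve 4 (λ p u y w → (p SS.:* (u SS.:* y)) SS.:* w SS.:= y SS.:* ((p SS.:* u) SS.:* w))
           S.refl A 1-X Y W) ⟩
    a • (Y ⊛ ((A ⊛ 1-X) ⊛ W))
      ≈⟨ •-congˡ a (⊛-congˡ Y (⊛-congʳ W (λ n → trans (⊛-congˡ A (λ n → sym (binom-neg1 n)) n) ([1-X]^-+ a 1# n)))) ⟩
    a • (Y ⊛ ([1-X]^ (a + 1#) ⊛ W))
      ≈⟨ •-congˡ a (⊛-congˡ Y ([1-X]^⊛fallingSeries (a + 1#) l)) ⟩
    a • (Y ⊛ (poch (a + 1#) l • Y ^ˢ l))
      ≈⟨ •-congˡ a (⊛-• (poch (a + 1#) l) Y (Y ^ˢ l)) ⟩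
    a • (poch (a + 1#) l • (Y ⊛ Y ^ˢ l))
      ≈⟨ (λ n → trans (sym (*-assoc a (poch (a + 1#) l) ((Y ⊛ Y ^ˢ l) n))) (*-congʳ (sym (poch-suc a l)))) ⟩
    poch a (suc l) • (Y ⊛ Y ^ˢ l) ∎
    where
    A = [1-X]^ a
    W = fallingSeries (a + 1#) l
    Y = X/[X-1]

  -- Newton's expansion of F, summed against (a)_n x^n / n!.
  generatingSeries-newton : ∀ m a F → Degree≤ m (F ∘ fromℕ) →
    generatingSeries a F ≋ sumˢ {suc m} (λ l → (1/ toℕ l ! * alternatingSum F (toℕ l)) • fallingSeries a (toℕ l))
  generatingSeries-newton m a F deg n =
    trans (*-congʳ (newton deg n))
    (trans (*-comm (∑≤ m q) (binom a n))
    (trans (∑≤-*ˡ m (binom a n) q)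
    (trans (∑≤-cong m term)
           (reflexive (≡.sym (sumˢ-coefficient {suc m} v n))))))
    where
    q : ℕ → Carrier
    q l = signedBinomial n l * Δ l (F ∘ fromℕ) 0
    v : Vector Series (suc m)
    v l = (1/ toℕ l ! * alternatingSum F (toℕ l)) • fallingSeries a (toℕ l)
    term : ∀ l → binom a n * q l ≈ (1/ l ! * alternatingSum F l) * (poch (- fromℕ n) l * binom a n)
    term l = trans (*-congˡ (*-congˡ (sym (alternatingSum≈Δ F l))))
      (solve 4 (λ b p r a → b :* (p :* r :* a) := r :* a :* (p :* b)) refl
        (binom a n) (poch (- fromℕ n) l) (1/ l !) (alternatingSum F l))

  -- It suffices that F agrees on the natural numbers with a polynomial of degree at most m.
  isWPolynomial : ∀ m a F → Degree≤ m (F ∘ fromℕ) → IsWPolynomial m a F (wPolynomial m a F)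
  isWPolynomial m a F deg = begin
    [1-X]^ a ⊛ generatingSeries a F
      ≈⟨ ⊛-congˡ ([1-X]^ a) (generatingSeries-newton m a F deg) ⟩
    [1-X]^ a ⊛ sumˢ v
      ≈⟨ ⊛-sumˢ ([1-X]^ a) v ⟩
    sumˢ (λ l → [1-X]^ a ⊛ v l)
      ≈⟨ sumˢ-cong term ⟩
    wPolynomial m a F ⟪ X/[X-1] ⟫ ∎
    where
    v : Vector Series (suc m)
    v l = (1/ toℕ l ! * alternatingSum F (toℕ l)) • fallingSeries a (toℕ l)
    term : ∀ l → [1-X]^ a ⊛ v l ≋ wPolynomial m a F l • X/[X-1] ^ˢ toℕ l
    term l n = trans (⊛-• x ([1-X]^ a) (fallingSeries a (toℕ l)) n)
      (trans (*-congˡ ([1-X]^⊛fallingSeries a (toℕ l) n))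
      (solve 4 (λ r s p y → r :* s :* (p :* y) := p :* r :* s :* y) refl
        (1/ toℕ l !) (alternatingSum F (toℕ l)) (poch a (toℕ l)) ((X/[X-1] ^ˢ toℕ l) n)))
      where x = 1/ toℕ l ! * alternatingSum F (toℕ l)

-- The polynomial ŵ

module HypergeometricPolynomials {c ℓ₁ ℓ₂} (K : HeytingField c ℓ₁ ℓ₂) (char0 : CharacteristicZero K) where

  open MillerParis K char0 hiding (_×_)
  open Arithmetic K char0
  open FiniteDifferences K char0
  open SeriesRing K char0
  open SeriesLemmas K char0
  open EulerTransform K char0
  open BinomialSeries K char0
  private
    module S = CommutativeRing seriesRing
    module SS = IntegerCoefficientSolver seriesRing
  open SetoidReasoning S.setoid

  [1-X]^-divide : ∀ α {s t} → [1-X]^ α ⊛ s ≋ t → s ≋ t ⊛ [1-X]^ (- α)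
  [1-X]^-divide α {s} {t} eq = begin
    s                                      ≈⟨ 𝟙-⊛ s ⟨
    𝟙 ⊛ s                                  ≈⟨ ⊛-congʳ s ([1-X]^-inverse α) ⟨
    ([1-X]^ α ⊛ [1-X]^ (- α)) ⊛ s          ≈⟨ SS.solve 3 (λ p q s → (p SS.:* q) SS.:* s SS.:= (p SS.:* s) SS.:* q)
         S.refl ([1-X]^ α) ([1-X]^ (- α)) s ⟩
    ([1-X]^ α ⊛ s) ⊛ [1-X]^ (- α)          ≈⟨ ⊛-congʳ ([1-X]^ (- α)) eq ⟩
    t ⊛ [1-X]^ (- α)                       ∎

  [1-X]^-multiply : ∀ α {s t} → s ≋ t ⊛ [1-X]^ (- α) → [1-X]^ α ⊛ s ≋ t
  [1-X]^-multiply α {s} {t} eq = begin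
    [1-X]^ α ⊛ s                           ≈⟨ ⊛-congˡ ([1-X]^ α) eq ⟩
    [1-X]^ α ⊛ (t ⊛ [1-X]^ (- α))          ≈⟨ SS.solve 3 (λ p q t → p SS.:* (t SS.:* q) SS.:= (p SS.:* q) SS.:* t)
         S.refl ([1-X]^ α) ([1-X]^ (- α)) t ⟩
    ([1-X]^ α ⊛ [1-X]^ (- α)) ⊛ t          ≈⟨ ⊛-congʳ t ([1-X]^-inverse α) ⟩
    𝟙 ⊛ t                                  ≈⟨ 𝟙-⊛ t ⟩
    t                                      ∎

  module _ {m a F} (w : Poly m) (w-isW : IsWPolynomial m a F w) where

    [1-X]^⊛generatingSeries : [1-X]^ (fromℕ m + a) ⊛ generatingSeries a F ≋ 1-X ^ˢ m ⊛ w ⟪ X/[X-1] ⟫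
    [1-X]^⊛generatingSeries = begin
      [1-X]^ (fromℕ m + a) ⊛ G                ≈⟨ ⊛-congʳ G ([1-X]^-+ (fromℕ m) a) ⟨
      ([1-X]^ fromℕ m ⊛ [1-X]^ a) ⊛ G         ≈⟨ ⊛-assoc ([1-X]^ fromℕ m) ([1-X]^ a) G ⟩
      [1-X]^ fromℕ m ⊛ ([1-X]^ a ⊛ G)         ≈⟨ ⊛-cong ([1-X]^fromℕ m) w-isW ⟩
      1-X ^ˢ m ⊛ w ⟪ X/[X-1] ⟫                ∎
      where G = generatingSeries a F

    ŵ-from-w : ∀ {ŵ} → IsŵPolynomial m a F ŵ → ŵ ⟪ X ⟫ ≋ 1-X ^ˢ m ⊛ w ⟪ X/[X-1] ⟫
    ŵ-from-w {ŵ} ŵ-isŵ n = trans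
      (sym ([1-X]^-multiply (fromℕ m + a) {generatingSeries a F} {ŵ ⟪ X ⟫} ŵ-isŵ n))
      ([1-X]^⊛generatingSeries n)

    -- The Bernstein combination with coefficients (-1)^k w_k has degree at most m, so it
    -- is the polynomial of its first m + 1 coefficients.
    ŵ-exists : ∃ (IsŵPolynomial m a F)
    ŵ-exists = ŵ , [1-X]^-divide (fromℕ m + a) {generatingSeries a F} {ŵ ⟪ X ⟫} (begin
      [1-X]^ (fromℕ m + a) ⊛ generatingSeries a F   ≈⟨ [1-X]^⊛generatingSeries ⟩
      1-X ^ˢ m ⊛ w ⟪ X/[X-1] ⟫                      ≈⟨ bernstein-sgn w ⟨
      bernstein b                                   ≈⟨ truncate m (bernstein b) (bernstein-degree b) ⟨
      ŵ ⟪ X ⟫                                       ∎)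
      where
      b : Vector Carrier (suc m)
      b k = sgn (toℕ k) * w k
      ŵ : Poly m
      ŵ = bernstein b ∘ toℕ

  -- The relation between p and q is symmetric by homogeneous-involution, so this serves
  -- both for p = ŵ, q = w and for p = w, q = ŵ.
  bernsteinCoefficients : ∀ {m} (p q : Poly m) → p ⟪ X ⟫ ≋ 1-X ^ˢ m ⊛ q ⟪ X/[X-1] ⟫ →
    ∀ b → (p ⟪ X ⟫ ≋ bernstein b) ⇔ (∀ k → b k ≈ sgn (toℕ k) * q k)
  bernsteinCoefficients {m} p q eq b = mk⇔
    (λ p≋b → bernstein-injective b b′ (λ n → trans (sym (p≋b n)) (p≋b′ n)))
    (λ b≈b′ n → trans (p≋b′ n) (sym (bernstein-cong b b′ b≈b′ n)))
    where
    b′ : Vector Carrier (suc m)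
    b′ k = sgn (toℕ k) * q k
    p≋b′ : p ⟪ X ⟫ ≋ bernstein b′
    p≋b′ n = trans (eq n) (sym (bernstein-sgn q n))

proposition2 :
  ∀ {c ℓ₁ ℓ₂} (K : HeytingField c ℓ₁ ℓ₂) (char0 : CharacteristicZero K) →
  let open MillerParis K char0 hiding (_×_) in
  ∀ (r-1 : ℕ) (ms : Vector ℕ (suc r-1)) (ms>0 : ∀ i → 0 ℕ.< ms i)
    (a : Carrier)
    (f : Vector Carrier (suc r-1)) (f≠ : ∀ i → NotNonpositiveInteger (f i)) →
  let m  = total ms
      m₁ = head ms
      f₁ = head f
      ω  = m ∸ m₁
      F  = pochQuotient ms f f≠
      H  = pochQuotient (tail ms) (tail f) (λ i → f≠ (suc i))
      Q  = MillerParisOperator ω (f₁ + fromℕ m₁) f₁ (poch-shift#0 f₁ m₁ ω (ms>0 zero)) H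
      w  = wPolynomial m a F
  in
  IsWPolynomial m a F w
  × ∃ (IsŵPolynomial m a F)
  × (∀ (ŵ : Poly m) → IsŵPolynomial m a F ŵ →
      (ŵ ⟪ X ⟫ ≋ 1-X ^ˢ m ⊛ w ⟪ X/[X-1] ⟫)
      × (ŵ ⟪ X ⟫ ≋ bernstein {m} (λ i → let k = toℕ i in
          sgn k
            * (poch a k * poch (- fromℕ m) k
                / poch f₁ k [ NotNonpositiveInteger⇒poch#0 (f≠ zero) k ] / k !)
            * Q (fromℕ k)))
      × (∀ (b : Vector Carrier (suc m)) →
          (ŵ ⟪ X ⟫ ≋ bernstein b) ⇔ (∀ k → b k ≈ sgn (toℕ k) * w k))
      × (∀ (b : Vector Carrier (suc m)) →
          (w ⟪ X ⟫ ≋ bernstein b) ⇔ (∀ k → b k ≈ sgn (toℕ k) * ŵ k)))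
proposition2 K char0 r-1 ms ms>0 a f f≠ =
    w-isW
  , ŵ-exists {m} {a} {F} w w-isW
  , λ ŵ ŵ-isŵ → main ŵ (ŵ-from-w {m} {a} {F} w w-isW {ŵ} ŵ-isŵ)
  where
  open MillerParis K char0 hiding (_×_)
  open Arithmetic K char0
  open Coefficients K char0
  open FiniteDifferences K char0
  open EulerTransform K char0
  open BinomialSeries K char0
  open HypergeometricPolynomials K char0
  m  = total ms
  m₁ = head ms
  f₁ = head f
  ω  = m ∸ m₁
  F  = pochQuotient ms f f≠
  H  = pochQuotient (tail ms) (tail f) (λ i → f≠ (suc i))
  ω≢0 = poch-shift#0 f₁ m₁ ω (ms>0 zero)
  Q  = MillerParisOperator ω (f₁ + fromℕ m₁) f₁ ω≢0 H
  w  = wPolynomial m a F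
  w-isW : IsWPolynomial m a F w
  w-isW = isWPolynomial m a F (Degree≤-pochQuotient ms f f≠)
  b : Vector Carrier (suc m)
  b i = let k = toℕ i in
    sgn k * (poch a k * poch (- fromℕ m) k / poch f₁ k [ NotNonpositiveInteger⇒poch#0 (f≠ zero) k ] / k !) * Q (fromℕ k)
  b≈sgn*w : ∀ i → b i ≈ sgn (toℕ i) * w i
  b≈sgn*w i = trans
    (solve 6 (λ s p q r k x → s :* (p :* q :* r :* k) :* x := s :* (p :* k :* (q :* r :* x))) refl
      (sgn k) (poch a k) (poch (- fromℕ m) k) (recip (NotNonpositiveInteger⇒poch#0 (f≠ zero) k)) (1/ k !) (Q (fromℕ k)))
    (*-congˡ (*-congˡ (sym (alternatingSum-pochQuotient ms f f≠ (ℕₚ.m+n∸m≡n m₁ (total (tail ms))) ω≢0 k))))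
    where k = toℕ i
  main : ∀ ŵ → ŵ ⟪ X ⟫ ≋ 1-X ^ˢ m ⊛ w ⟪ X/[X-1] ⟫ →
    (ŵ ⟪ X ⟫ ≋ 1-X ^ˢ m ⊛ w ⟪ X/[X-1] ⟫)
    × (ŵ ⟪ X ⟫ ≋ bernstein b)
    × (∀ b → (ŵ ⟪ X ⟫ ≋ bernstein b) ⇔ (∀ k → b k ≈ sgn (toℕ k) * w k))
    × (∀ b → (w ⟪ X ⟫ ≋ bernstein b) ⇔ (∀ k → b k ≈ sgn (toℕ k) * ŵ k))
  main ŵ ŵ≋ =
      ŵ≋
    , Equivalence.from (bernsteinCoefficients ŵ w ŵ≋ b) b≈sgn*w
    , bernsteinCoefficients ŵ w ŵ≋
    , bernsteinCoefficients w ŵ (homogeneous-involution ŵ w ŵ≋)
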